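{- Let $\nu,\mu$ be computable probability measures on Cantor space $2^{\mathbb{N}}$ with full support. If $\nu\ll_{kl}\mu$, then $\nu \ll_{\mathsf{MLR}} \mu$.
   Context: A probability measure $\nu$ on Cantor space is identified with the function $\sigma\mapsto\nu(\sigma):=\nu([\sigma])$ on $2^{<\mathbb{N}}$, where $[\sigma]$ is the set of $\omega\in 2^{\mathbb{N}}$ extending $\sigma$. It is computable if the reals $\nu(\sigma)$ are computable uniformly in $\sigma$; it has full support if $\nu(\sigma)>0$ for all $\sigma$. $\omega\upharpoonright n$ is the length-$n$ initial segment of $\omega$. $\nu\ll_{kl}\mu$ iff $\sup_n \mathbb{E}_{\nu}\ln\frac{\nu(\cdot\upharpoonright n)}{\mu(\cdot\upharpoonright n)}$ (expectation of $\omega\mapsto \ln\frac{\nu(\omega\upharpoonright n)}{\mu(\omega\upharpoonright n)}$) is finite. A c.e. open set is one of the form $\bigcup_n[\sigma_n]$ for a computable sequence $\sigma_n$ of binary strings. $\mathsf{MLR}^{\nu}$ (Martin-Löf $\nu$-random points) is the set of $\omega$ such that $\omega\notin\bigcap_n U_n$ for every computable sequence $U_n$ of c.e. opens with $\nu(U_n)\le 2^{ -n}$ for all $n\ge 0$. $\nu\ll_{\mathsf{MLR}}\mu$ means $\mathsf{MLR}^{\nu}\subseteq\mathsf{MLR}^{\mu}$. -}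

module Defs where

open import Data.Bool.Base using (Bool; true; false; if_then_else_)
import Data.Bool.Properties as Bool
open import Data.Fin.Base using (Fin)
open import Data.Integer.Base as ℤ using (ℤ; +_; +0; +[1+_]; -[1+_])
import Data.Integer.Properties as ℤ
open import Data.List.Base as List using (List; []; _∷_; _∷ʳ_; length; applyUpTo; concatMap; foldr)
open import Data.List.Relation.Unary.Any using (any?)
open import Data.List.Relation.Binary.Prefix.Heterogeneous using (Prefix)
open import Data.List.Relation.Binary.Prefix.Heterogeneous.Properties using (prefix?)
open import Data.Nat.Base as ℕ using (ℕ; zero; suc; z≤n; s≤s)
import Data.Nat.Properties as ℕ
open import Data.Product.Base using (Σ; ∃; ∃-syntax; _×_; _,_; proj₁; proj₂)
open import Data.Rational.Base as ℚ using (ℚ; mkℚ; 0ℚ; 1ℚ; ½; ↥_; ↧ₙ_; ∣_∣)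
import Data.Rational.Properties as ℚ
import Data.Rational.Unnormalised.Base as ℚᵘ
import Data.Rational.Unnormalised.Properties as ℚᵘ
open import Data.Rational.Solver using (module +-*-Solver)
open import Data.Sum.Base using (inj₁; inj₂)
open import Data.Vec.Base using (Vec; []; _∷_; lookup)
open import Relation.Binary.PropositionalEquality
  using (_≡_; refl; sym; trans; cong; cong₂; subst; subst₂)
open import Relation.Nullary using (¬_; does)

-- 2⁻ n = 2^(-n)
2⁻ : ℕ → ℚ
2⁻ zero    = 1ℚ
2⁻ (suc n) = ½ ℚ.* 2⁻ n

-- Reciprocal, with the junk value inv 0 = 0.  It is only ever used on
-- sequences that are eventually bounded below by a positive rational.
inv : ℚ → ℚ
inv   (mkℚ +0       _ _) = 0ℚ
inv p@(mkℚ +[1+ _ ] _ _) = ℚ.1/ p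
inv p@(mkℚ -[1+ _ ] _ _) = ℚ.1/ p

-- Right-endpoint Riemann sum of f over [a , b] for the partition into
-- 2^k pieces of equal length.
riemann : (ℚ → ℚ) → ℕ → ℚ → ℚ → ℚ
riemann f zero    a b = (b ℚ.- a) ℚ.* f b
riemann f (suc k) a b = riemann f k a m ℚ.+ riemann f k m b
  where
  m : ℚ
  m = (a ℚ.+ b) ℚ.* ½

0<½ : 0ℚ ℚ.< ½
0<½ = ℚ.positive⁻¹ ½

0<1 : 0ℚ ℚ.< 1ℚ
0<1 = ℚ.positive⁻¹ 1ℚ

0≤+ : ∀ {p q} → 0ℚ ℚ.≤ p → 0ℚ ℚ.≤ q → 0ℚ ℚ.≤ p ℚ.+ q
0≤+ = ℚ.+-mono-≤

0<+ : ∀ {p q} → 0ℚ ℚ.< p → 0ℚ ℚ.≤ q → 0ℚ ℚ.< p ℚ.+ q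
0<+ = ℚ.+-mono-<-≤

*-monoʳ : ∀ {r p q} → 0ℚ ℚ.≤ r → p ℚ.≤ q → r ℚ.* p ℚ.≤ r ℚ.* q
*-monoʳ {r} 0≤r = ℚ.*-monoˡ-≤-nonNeg r {{ℚ.nonNegative 0≤r}}

*-monoˡ : ∀ {r p q} → 0ℚ ℚ.≤ r → p ℚ.≤ q → p ℚ.* r ℚ.≤ q ℚ.* r
*-monoˡ {r} 0≤r = ℚ.*-monoʳ-≤-nonNeg r {{ℚ.nonNegative 0≤r}}

*-mono : ∀ {p q r s} → 0ℚ ℚ.≤ r → 0ℚ ℚ.≤ q → p ℚ.≤ q → r ℚ.≤ s → p ℚ.* r ℚ.≤ q ℚ.* s
*-mono 0≤r 0≤q p≤q r≤s = ℚ.≤-trans (*-monoˡ 0≤r p≤q) (*-monoʳ 0≤q r≤s)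

0≤* : ∀ {p q} → 0ℚ ℚ.≤ p → 0ℚ ℚ.≤ q → 0ℚ ℚ.≤ p ℚ.* q
0≤* {p} {q} 0≤p 0≤q = ℚ.nonNegative⁻¹ (p ℚ.* q)
  {{ℚ.nonNeg*nonNeg⇒nonNeg p {{ℚ.nonNegative 0≤p}} q {{ℚ.nonNegative 0≤q}}}}

≤+ʳ : ∀ p {q} → 0ℚ ℚ.≤ q → p ℚ.≤ p ℚ.+ q
≤+ʳ p {q} 0≤q = subst (ℚ._≤ p ℚ.+ q) (ℚ.+-identityʳ p) (ℚ.+-monoʳ-≤ p 0≤q)

≤+ˡ : ∀ p {q} → 0ℚ ℚ.≤ q → p ℚ.≤ q ℚ.+ p
≤+ˡ p {q} 0≤q = subst (ℚ._≤ q ℚ.+ p) (ℚ.+-identityˡ p) (ℚ.+-monoˡ-≤ p 0≤q)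

0<* : ∀ {p q} → 0ℚ ℚ.< p → 0ℚ ℚ.< q → 0ℚ ℚ.< p ℚ.* q
0<* {p} {q} 0<p 0<q = ℚ.positive⁻¹ (p ℚ.* q)
  {{ℚ.pos*pos⇒pos p {{ℚ.positive 0<p}} q {{ℚ.positive 0<q}}}}

0<⇒NonZero : ∀ {p} → 0ℚ ℚ.< p → ℚ.NonZero p
0<⇒NonZero {p} 0<p = ℚ.pos⇒nonZero p {{ℚ.positive 0<p}}

inv-def : ∀ p .{{_ : ℚ.NonZero p}} → inv p ≡ ℚ.1/ p
inv-def (mkℚ +[1+ _ ] _ _) = refl
inv-def (mkℚ -[1+ _ ] _ _) = refl

inv-inverseʳ : ∀ {p} → 0ℚ ℚ.< p → p ℚ.* inv p ≡ 1ℚ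
inv-inverseʳ {p} 0<p = trans (cong (p ℚ.*_) (inv-def p)) (ℚ.*-inverseʳ p)
  where instance _ = 0<⇒NonZero 0<p

inv-pos : ∀ {p} → 0ℚ ℚ.< p → 0ℚ ℚ.< inv p
inv-pos {p} 0<p = subst (0ℚ ℚ.<_) (sym (inv-def p))
  (ℚ.positive⁻¹ (ℚ.1/ p) {{ℚ.1/pos⇒pos p {{ℚ.positive 0<p}}}})
  where instance _ = 0<⇒NonZero 0<p

inv-nonNeg : ∀ {p} → 0ℚ ℚ.< p → 0ℚ ℚ.≤ inv p
inv-nonNeg 0<p = ℚ.<⇒≤ (inv-pos 0<p)

inv-anti : ∀ {p q} → 0ℚ ℚ.< p → p ℚ.≤ q → inv q ℚ.≤ inv p
inv-anti {p} {q} 0<p p≤q = subst₂ ℚ._≤_ eq₁ eq₂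
    (*-monoʳ (0≤* (inv-nonNeg 0<p) (inv-nonNeg 0<q)) p≤q)
  where
  open +-*-Solver
  0<q : 0ℚ ℚ.< q
  0<q = ℚ.<-≤-trans 0<p p≤q
  eq₁ : (inv p ℚ.* inv q) ℚ.* p ≡ inv q
  eq₁ = trans (solve 3 (λ u v x → (u :* v) :* x := (x :* u) :* v) refl (inv p) (inv q) p)
        (trans (cong (ℚ._* inv q) (inv-inverseʳ 0<p)) (ℚ.*-identityˡ (inv q)))
  eq₂ : (inv p ℚ.* inv q) ℚ.* q ≡ inv p
  eq₂ = trans (ℚ.*-assoc (inv p) (inv q) q)
        (trans (cong (inv p ℚ.*_) (trans (ℚ.*-comm (inv q) q) (inv-inverseʳ 0<q)))
               (ℚ.*-identityʳ (inv p)))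

2⁻-pos : ∀ n → 0ℚ ℚ.< 2⁻ n
2⁻-pos zero    = 0<1
2⁻-pos (suc n) = 0<* 0<½ (2⁻-pos n)

p≤∣p∣ : ∀ p → p ℚ.≤ ∣ p ∣
p≤∣p∣ (mkℚ (+ _) _ _)     = ℚ.≤-refl
p≤∣p∣ p@(mkℚ -[1+ _ ] _ _) = ℚ.≤-trans (ℚ.<⇒≤ (ℚ.negative⁻¹ p)) (ℚ.0≤∣p∣ p)

∣-∣≤ : ∀ {p q} → p ℚ.≤ q → ℚ.- p ℚ.≤ q → ∣ p ∣ ℚ.≤ q
∣-∣≤ {p} p≤q -p≤q with ℚ.∣p∣≡p∨∣p∣≡-p p
... | inj₁ eq = subst (ℚ._≤ _) (sym eq) p≤q
... | inj₂ eq = subst (ℚ._≤ _) (sym eq) -p≤q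

p-q≤r⇒p≤q+r : ∀ p q r → p ℚ.- q ℚ.≤ r → p ℚ.≤ q ℚ.+ r
p-q≤r⇒p≤q+r p q r h = subst (ℚ._≤ q ℚ.+ r)
  (solve 2 (λ x y → y :+ (x :- y) := x) refl p q) (ℚ.+-monoʳ-≤ q h)
  where open +-*-Solver

p≤q+r⇒p-q≤r : ∀ p q r → p ℚ.≤ q ℚ.+ r → p ℚ.- q ℚ.≤ r
p≤q+r⇒p-q≤r p q r h = subst (p ℚ.- q ℚ.≤_)
  (solve 2 (λ y z → (y :+ z) :- y := z) refl q r) (ℚ.+-monoˡ-≤ (ℚ.- q) h)
  where open +-*-Solver

-‿swap : ∀ p q → ℚ.- (p ℚ.- q) ≡ q ℚ.- p
-‿swap = solve 2 (λ x y → :- (x :- y) := y :- x) refl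
  where open +-*-Solver

∣-∣-swap : ∀ p q → ∣ p ℚ.- q ∣ ≡ ∣ q ℚ.- p ∣
∣-∣-swap p q = trans (sym (ℚ.∣-p∣≡∣p∣ (p ℚ.- q))) (cong ∣_∣ (-‿swap p q))

∣-∣-triangle : ∀ p q r → ∣ p ℚ.- r ∣ ℚ.≤ ∣ p ℚ.- q ∣ ℚ.+ ∣ q ℚ.- r ∣
∣-∣-triangle p q r = subst (λ s → ∣ s ∣ ℚ.≤ ∣ p ℚ.- q ∣ ℚ.+ ∣ q ℚ.- r ∣)
  (solve 3 (λ x y z → (x :- y) :+ (y :- z) := x :- z) refl p q r)
  (ℚ.∣p+q∣≤∣p∣+∣q∣ (p ℚ.- q) (q ℚ.- r))
  where open +-*-Solver

IsCauchy : (ℕ → ℚ) → Set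
IsCauchy x = ∀ ε → 0ℚ ℚ.< ε →
  ∃[ N ] (∀ m n → N ℕ.≤ m → N ℕ.≤ n → ∣ x m ℚ.- x n ∣ ℚ.≤ ε)

record ℝ : Set where
  constructor mkℝ
  field
    seq    : ℕ → ℚ
    cauchy : IsCauchy seq

open ℝ public

infix 4 _≈_ _≤_ _<_

_≈_ : ℝ → ℝ → Set
x ≈ y = ∀ ε → 0ℚ ℚ.< ε →
  ∃[ N ] (∀ n → N ℕ.≤ n → ∣ seq x n ℚ.- seq y n ∣ ℚ.≤ ε)

_≤_ : ℝ → ℝ → Set
x ≤ y = ∀ ε → 0ℚ ℚ.< ε →
  ∃[ N ] (∀ n → N ℕ.≤ n → seq x n ℚ.≤ seq y n ℚ.+ ε)

_<_ : ℝ → ℝ → Set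
x < y = ∃[ ε ] (0ℚ ℚ.< ε ×
  ∃[ N ] (∀ n → N ℕ.≤ n → seq x n ℚ.+ ε ℚ.≤ seq y n))

-- A sequence that moves, from some index on, by at most a constant
-- times the sum of the moves of two Cauchy sequences is Cauchy.
cauchy-lipschitz : ∀ x y (z : ℕ → ℚ) K → 0ℚ ℚ.< K → ∀ N →
  (∀ m n → N ℕ.≤ m → N ℕ.≤ n →
     ∣ z m ℚ.- z n ∣ ℚ.≤ K ℚ.* (∣ seq x m ℚ.- seq x n ∣ ℚ.+ ∣ seq y m ℚ.- seq y n ∣)) →
  IsCauchy z
cauchy-lipschitz x y z K 0<K N lip ε 0<ε = N ℕ.⊔ (N₁ ℕ.⊔ N₂) , bound
  where
  open +-*-Solver
  δ : ℚ
  δ = (ε ℚ.* inv K) ℚ.* ½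
  0<δ : 0ℚ ℚ.< δ
  0<δ = 0<* (0<* 0<ε (inv-pos 0<K)) 0<½
  N₁ N₂ : ℕ
  N₁ = proj₁ (cauchy x δ 0<δ)
  N₂ = proj₁ (cauchy y δ 0<δ)
  Kδ+δ≡ε : K ℚ.* (δ ℚ.+ δ) ≡ ε
  Kδ+δ≡ε = trans
    (solve 3 (λ k e i → k :* ((e :* i) :* con ½ :+ (e :* i) :* con ½) := e :* (k :* i)) refl K ε (inv K))
    (trans (cong (ε ℚ.*_) (inv-inverseʳ 0<K)) (ℚ.*-identityʳ ε))
  bound : ∀ m n → N ℕ.⊔ (N₁ ℕ.⊔ N₂) ℕ.≤ m → N ℕ.⊔ (N₁ ℕ.⊔ N₂) ℕ.≤ n → ∣ z m ℚ.- z n ∣ ℚ.≤ ε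
  bound m n p q = ℚ.≤-trans (lip m n (ℕ.m⊔n≤o⇒m≤o N _ p) (ℕ.m⊔n≤o⇒m≤o N _ q))
    (subst (K ℚ.* (∣ seq x m ℚ.- seq x n ∣ ℚ.+ ∣ seq y m ℚ.- seq y n ∣) ℚ.≤_) Kδ+δ≡ε
      (*-monoʳ (ℚ.<⇒≤ 0<K) (ℚ.+-mono-≤
        (proj₂ (cauchy x δ 0<δ) m n (ℕ.m⊔n≤o⇒m≤o N₁ _ p') (ℕ.m⊔n≤o⇒m≤o N₁ _ q'))
        (proj₂ (cauchy y δ 0<δ) m n (ℕ.m⊔n≤o⇒n≤o N₁ _ p') (ℕ.m⊔n≤o⇒n≤o N₁ _ q')))))
    where
    p' = ℕ.m⊔n≤o⇒n≤o N _ p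
    q' = ℕ.m⊔n≤o⇒n≤o N _ q

cauchy-bounded : ∀ x →
  ∃[ B ] (0ℚ ℚ.< B × ∃[ N ] (∀ n → N ℕ.≤ n → ∣ seq x n ∣ ℚ.≤ B))
cauchy-bounded x = ∣ seq x N ∣ ℚ.+ 1ℚ , ℚ.+-mono-≤-< (ℚ.0≤∣p∣ (seq x N)) 0<1 , N , bound
  where
  open +-*-Solver
  N : ℕ
  N = proj₁ (cauchy x 1ℚ 0<1)
  bound : ∀ n → N ℕ.≤ n → ∣ seq x n ∣ ℚ.≤ ∣ seq x N ∣ ℚ.+ 1ℚ
  bound n N≤n = subst (λ p → ∣ p ∣ ℚ.≤ ∣ seq x N ∣ ℚ.+ 1ℚ)
    (solve 2 (λ a b → a :+ (b :- a) := b) refl (seq x N) (seq x n))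
    (ℚ.≤-trans (ℚ.∣p+q∣≤∣p∣+∣q∣ (seq x N) (seq x n ℚ.- seq x N))
      (ℚ.+-monoʳ-≤ ∣ seq x N ∣ (proj₂ (cauchy x 1ℚ 0<1) n N N≤n ℕ.≤-refl)))

cauchy-const : ∀ q → IsCauchy (λ _ → q)
cauchy-const q ε 0<ε = 0 , λ _ _ _ _ →
  subst (λ p → ∣ p ∣ ℚ.≤ ε) (sym (ℚ.+-inverseʳ q)) (ℚ.<⇒≤ 0<ε)

fromℚ : ℚ → ℝ
fromℚ q = mkℝ (λ _ → q) (cauchy-const q)

0ℝ 1ℝ : ℝ
0ℝ = fromℚ 0ℚ
1ℝ = fromℚ 1ℚ

infixl 6 _+_
infixl 7 _*_ _/_⟨_⟩

_+_ : ℝ → ℝ → ℝ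
x + y = mkℝ (λ n → seq x n ℚ.+ seq y n)
  (cauchy-lipschitz x y (λ n → seq x n ℚ.+ seq y n) 1ℚ 0<1 0 λ m n _ _ →
    subst₂ ℚ._≤_
      (cong ∣_∣ (solve 4 (λ a b c d → (a :- b) :+ (c :- d) := (a :+ c) :- (b :+ d)) refl
        (seq x m) (seq x n) (seq y m) (seq y n)))
      (sym (ℚ.*-identityˡ _))
      (ℚ.∣p+q∣≤∣p∣+∣q∣ (seq x m ℚ.- seq x n) (seq y m ℚ.- seq y n)))
  where open +-*-Solver

_*_ : ℝ → ℝ → ℝ
x * y = mkℝ (λ n → seq x n ℚ.* seq y n)
  (cauchy-lipschitz x y (λ n → seq x n ℚ.* seq y n) (B₁ ℚ.+ B₂) (0<+ 0<B₁ (ℚ.<⇒≤ 0<B₂)) (N₁ ℕ.⊔ N₂) bound)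
  where
  open +-*-Solver
  bx = cauchy-bounded x
  by = cauchy-bounded y
  B₁ B₂ : ℚ
  B₁ = proj₁ bx
  B₂ = proj₁ by
  0<B₁ : 0ℚ ℚ.< B₁
  0<B₁ = proj₁ (proj₂ bx)
  0<B₂ : 0ℚ ℚ.< B₂
  0<B₂ = proj₁ (proj₂ by)
  N₁ N₂ : ℕ
  N₁ = proj₁ (proj₂ (proj₂ bx))
  N₂ = proj₁ (proj₂ (proj₂ by))
  bound : ∀ m n → N₁ ℕ.⊔ N₂ ℕ.≤ m → N₁ ℕ.⊔ N₂ ℕ.≤ n →
    ∣ seq x m ℚ.* seq y m ℚ.- seq x n ℚ.* seq y n ∣ ℚ.≤
      (B₁ ℚ.+ B₂) ℚ.* (∣ seq x m ℚ.- seq x n ∣ ℚ.+ ∣ seq y m ℚ.- seq y n ∣)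
  bound m n p q = begin
    ∣ a ℚ.* c ℚ.- b ℚ.* d ∣
      ≡⟨ cong ∣_∣ (solve 4 (λ a b c d → a :* c :- b :* d := a :* (c :- d) :+ d :* (a :- b)) refl a b c d) ⟩
    ∣ a ℚ.* (c ℚ.- d) ℚ.+ d ℚ.* (a ℚ.- b) ∣
      ≤⟨ ℚ.∣p+q∣≤∣p∣+∣q∣ (a ℚ.* (c ℚ.- d)) (d ℚ.* (a ℚ.- b)) ⟩
    ∣ a ℚ.* (c ℚ.- d) ∣ ℚ.+ ∣ d ℚ.* (a ℚ.- b) ∣
      ≡⟨ cong₂ ℚ._+_ (ℚ.∣p*q∣≡∣p∣*∣q∣ a (c ℚ.- d)) (ℚ.∣p*q∣≡∣p∣*∣q∣ d (a ℚ.- b)) ⟩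
    ∣ a ∣ ℚ.* ∣ c ℚ.- d ∣ ℚ.+ ∣ d ∣ ℚ.* ∣ a ℚ.- b ∣
      ≤⟨ ℚ.+-mono-≤
           (*-monoˡ (ℚ.0≤∣p∣ (c ℚ.- d)) (ℚ.≤-trans (proj₂ (proj₂ (proj₂ bx)) m (ℕ.m⊔n≤o⇒m≤o N₁ N₂ p)) B₁≤B))
           (*-monoˡ (ℚ.0≤∣p∣ (a ℚ.- b)) (ℚ.≤-trans (proj₂ (proj₂ (proj₂ by)) n (ℕ.m⊔n≤o⇒n≤o N₁ N₂ q)) B₂≤B)) ⟩
    (B₁ ℚ.+ B₂) ℚ.* ∣ c ℚ.- d ∣ ℚ.+ (B₁ ℚ.+ B₂) ℚ.* ∣ a ℚ.- b ∣
      ≡⟨ solve 3 (λ k s t → k :* s :+ k :* t := k :* (t :+ s)) refl (B₁ ℚ.+ B₂) ∣ c ℚ.- d ∣ ∣ a ℚ.- b ∣ ⟩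
    (B₁ ℚ.+ B₂) ℚ.* (∣ a ℚ.- b ∣ ℚ.+ ∣ c ℚ.- d ∣) ∎
    where
    open ℚ.≤-Reasoning
    a = seq x m
    b = seq x n
    c = seq y m
    d = seq y n
    B₁≤B : B₁ ℚ.≤ B₁ ℚ.+ B₂
    B₁≤B = subst (ℚ._≤ B₁ ℚ.+ B₂) (ℚ.+-identityʳ B₁) (ℚ.+-monoʳ-≤ B₁ (ℚ.<⇒≤ 0<B₂))
    B₂≤B : B₂ ℚ.≤ B₁ ℚ.+ B₂
    B₂≤B = subst (ℚ._≤ B₁ ℚ.+ B₂) (ℚ.+-identityˡ B₂) (ℚ.+-monoˡ-≤ B₂ (ℚ.<⇒≤ 0<B₁))

pos-lower : ∀ {y} → 0ℝ < y → ∃[ c ] (0ℚ ℚ.< c × ∃[ N ] (∀ n → N ℕ.≤ n → c ℚ.≤ seq y n))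
pos-lower (ε , 0<ε , N , h) = ε , 0<ε , N , λ n p → subst (ℚ._≤ _) (ℚ.+-identityˡ ε) (h n p)

inv-diff : ∀ {p q} → 0ℚ ℚ.< p → 0ℚ ℚ.< q →
  inv p ℚ.- inv q ≡ (inv p ℚ.* inv q) ℚ.* (q ℚ.- p)
inv-diff {p} {q} 0<p 0<q = sym (trans
  (solve 4 (λ x y u v → (u :* v) :* (y :- x) := u :* (y :* v) :- v :* (x :* u)) refl p q (inv p) (inv q))
  (trans (cong₂ (λ s t → inv p ℚ.* s ℚ.- inv q ℚ.* t) (inv-inverseʳ 0<q) (inv-inverseʳ 0<p))
         (cong₂ ℚ._-_ (ℚ.*-identityʳ (inv p)) (ℚ.*-identityʳ (inv q)))))
  where open +-*-Solver

recip : (y : ℝ) → 0ℝ < y → ℝ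
recip y 0<y = mkℝ (λ n → inv (seq y n))
  (cauchy-lipschitz y 0ℝ (λ n → inv (seq y n)) (inv c ℚ.* inv c) (0<* (inv-pos 0<c) (inv-pos 0<c)) N bound)
  where
  pl = pos-lower {y} 0<y
  c : ℚ
  c = proj₁ pl
  0<c : 0ℚ ℚ.< c
  0<c = proj₁ (proj₂ pl)
  N : ℕ
  N = proj₁ (proj₂ (proj₂ pl))
  c≤ : ∀ n → N ℕ.≤ n → c ℚ.≤ seq y n
  c≤ = proj₂ (proj₂ (proj₂ pl))
  bound : ∀ m n → N ℕ.≤ m → N ℕ.≤ n →
    ∣ inv (seq y m) ℚ.- inv (seq y n) ∣ ℚ.≤
      (inv c ℚ.* inv c) ℚ.* (∣ seq y m ℚ.- seq y n ∣ ℚ.+ ∣ 0ℚ ℚ.- 0ℚ ∣)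
  bound m n p q = begin
    ∣ inv a ℚ.- inv b ∣                    ≡⟨ cong ∣_∣ (inv-diff 0<a 0<b) ⟩
    ∣ (inv a ℚ.* inv b) ℚ.* (b ℚ.- a) ∣    ≡⟨ ℚ.∣p*q∣≡∣p∣*∣q∣ (inv a ℚ.* inv b) (b ℚ.- a) ⟩
    ∣ inv a ℚ.* inv b ∣ ℚ.* ∣ b ℚ.- a ∣    ≡⟨ cong₂ ℚ._*_ (ℚ.0≤p⇒∣p∣≡p (0≤* (inv-nonNeg 0<a) (inv-nonNeg 0<b))) (∣-∣-swap b a) ⟩
    (inv a ℚ.* inv b) ℚ.* ∣ a ℚ.- b ∣      ≤⟨ *-monoˡ (ℚ.0≤∣p∣ (a ℚ.- b))
                                                (*-mono (inv-nonNeg 0<b) (inv-nonNeg 0<c) (inv-anti 0<c (c≤ m p)) (inv-anti 0<c (c≤ n q))) ⟩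
    (inv c ℚ.* inv c) ℚ.* ∣ a ℚ.- b ∣      ≡⟨ cong ((inv c ℚ.* inv c) ℚ.*_) (ℚ.+-identityʳ ∣ a ℚ.- b ∣) ⟨
    (inv c ℚ.* inv c) ℚ.* (∣ a ℚ.- b ∣ ℚ.+ 0ℚ) ∎
    where
    open ℚ.≤-Reasoning
    a = seq y m
    b = seq y n
    0<a : 0ℚ ℚ.< a
    0<a = ℚ.<-≤-trans 0<c (c≤ m p)
    0<b : 0ℚ ℚ.< b
    0<b = ℚ.<-≤-trans 0<c (c≤ n q)

_/_⟨_⟩ : ℝ → (y : ℝ) → 0ℝ < y → ℝ
x / y ⟨ 0<y ⟩ = x * recip y 0<y

/-pos : ∀ {x y} → 0ℝ < x → (0<y : 0ℝ < y) → 0ℝ < x / y ⟨ 0<y ⟩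
/-pos {x} {y} 0<x 0<y =
    c ℚ.* inv B , 0<* 0<c (inv-pos 0<B) , N₁ ℕ.⊔ (N₂ ℕ.⊔ N₃) , λ n p →
      quotient (seq x n) (seq y n)
        (proj₂ (proj₂ (proj₂ px)) n (ℕ.m⊔n≤o⇒m≤o N₁ _ p))
        (proj₂ (proj₂ (proj₂ py)) n (ℕ.m⊔n≤o⇒m≤o N₂ N₃ (ℕ.m⊔n≤o⇒n≤o N₁ _ p)))
        (proj₂ (proj₂ (proj₂ by)) n (ℕ.m⊔n≤o⇒n≤o N₂ N₃ (ℕ.m⊔n≤o⇒n≤o N₁ _ p)))
  where
  px = pos-lower {x} 0<x
  py = pos-lower {y} 0<y
  by = cauchy-bounded y
  c d B : ℚ
  c = proj₁ px
  d = proj₁ py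
  B = proj₁ by
  N₁ N₂ N₃ : ℕ
  N₁ = proj₁ (proj₂ (proj₂ px))
  N₂ = proj₁ (proj₂ (proj₂ py))
  N₃ = proj₁ (proj₂ (proj₂ by))
  0<c : 0ℚ ℚ.< c
  0<c = proj₁ (proj₂ px)
  0<d : 0ℚ ℚ.< d
  0<d = proj₁ (proj₂ py)
  0<B : 0ℚ ℚ.< B
  0<B = proj₁ (proj₂ by)
  quotient : ∀ a b → c ℚ.≤ a → d ℚ.≤ b → ∣ b ∣ ℚ.≤ B → 0ℚ ℚ.+ c ℚ.* inv B ℚ.≤ a ℚ.* inv b
  quotient a b c≤a d≤b b≤B = subst (ℚ._≤ a ℚ.* inv b) (sym (ℚ.+-identityˡ (c ℚ.* inv B)))
    (*-mono {c} {a} {inv B} {inv b} (inv-nonNeg 0<B) (ℚ.≤-trans (ℚ.<⇒≤ 0<c) c≤a) c≤a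
      (inv-anti {b} {B} (ℚ.<-≤-trans 0<d d≤b) (ℚ.≤-trans (p≤∣p∣ b) b≤B)))

ι : ℕ → ℚ
ι zero    = 0ℚ
ι (suc n) = 1ℚ ℚ.+ ι n

ι-toℚᵘ : ∀ n → ℚ.toℚᵘ (ι n) ℚᵘ.≃ ℚᵘ.mkℚᵘ (+ n) 0
ι-toℚᵘ zero    = ℚᵘ.≃-refl
ι-toℚᵘ (suc n) = ℚᵘ.≃-trans (ℚ.toℚᵘ-homo-+ 1ℚ (ι n))
  (ℚᵘ.≃-trans (ℚᵘ.+-congʳ (ℚ.toℚᵘ 1ℚ) (ι-toℚᵘ n))
    (ℚᵘ.*≡* (cong (λ k → (+ 1 ℤ.+ k) ℤ.* + 1) (ℤ.*-identityʳ (+ n)))))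

archimedean : ∀ p → ∃[ n ] p ℚ.≤ ι n
archimedean p = ℤ.∣ ↥ p ∣ , ℚ.toℚᵘ-cancel-≤
  (ℚᵘ.≤-respʳ-≃ (ℚᵘ.≃-sym (ι-toℚᵘ ℤ.∣ ↥ p ∣)) (numerator p))
  where
  numerator : ∀ q → ℚ.toℚᵘ q ℚᵘ.≤ ℚᵘ.mkℚᵘ (+ ℤ.∣ ↥ q ∣) 0
  numerator (mkℚ (+ k) d _)    = ℚᵘ.*≤* (ℤ.*-monoˡ-≤-nonNeg (+ k) (ℤ.+≤+ (s≤s z≤n)))
  numerator (mkℚ -[1+ k ] d _) = ℚᵘ.*≤* ℤ.-≤+

2⁻-step : ∀ n → 2⁻ (suc n) ℚ.≤ 2⁻ n
2⁻-step n = subst (2⁻ (suc n) ℚ.≤_) (ℚ.*-identityˡ (2⁻ n))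
  (*-monoˡ (ℚ.<⇒≤ (2⁻-pos n)) (ℚ.≤ᵇ⇒≤ {½} {1ℚ} _))

2⁻-anti′ : ∀ {m n} → m ℕ.≤′ n → 2⁻ n ℚ.≤ 2⁻ m
2⁻-anti′ ℕ.≤′-refl              = ℚ.≤-refl
2⁻-anti′ (ℕ.≤′-step {n} m≤n) = ℚ.≤-trans (2⁻-step n) (2⁻-anti′ m≤n)

2⁻-anti : ∀ {m n} → m ℕ.≤ n → 2⁻ n ℚ.≤ 2⁻ m
2⁻-anti m≤n = 2⁻-anti′ (ℕ.≤⇒≤′ m≤n)

ι*2⁻≤1 : ∀ n → ι n ℚ.* 2⁻ n ℚ.≤ 1ℚ
ι*2⁻≤1 zero    = ℚ.≤ᵇ⇒≤ {0ℚ ℚ.* 1ℚ} {1ℚ} _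
ι*2⁻≤1 (suc n) = subst (ℚ._≤ 1ℚ)
  (solve 3 (λ t h k → h :* (t :+ k :* t) := (con 1ℚ :+ k) :* (h :* t)) refl (2⁻ n) ½ (ι n))
  (*-monoʳ {½} (ℚ.<⇒≤ 0<½) (ℚ.+-mono-≤ (2⁻-anti {0} {n} z≤n) (ι*2⁻≤1 n)))
  where open +-*-Solver

2⁻-small : ∀ ε → 0ℚ ℚ.< ε → ∃[ n ] 2⁻ n ℚ.≤ ε
2⁻-small ε 0<ε = n , (begin
  2⁻ n                        ≡⟨ ℚ.*-identityˡ (2⁻ n) ⟨
  1ℚ ℚ.* 2⁻ n                 ≡⟨ cong (ℚ._* 2⁻ n) (inv-inverseʳ 0<ε) ⟨
  (ε ℚ.* inv ε) ℚ.* 2⁻ n      ≡⟨ ℚ.*-assoc ε (inv ε) (2⁻ n) ⟩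
  ε ℚ.* (inv ε ℚ.* 2⁻ n)      ≤⟨ *-monoʳ (ℚ.<⇒≤ 0<ε) (*-monoˡ (ℚ.<⇒≤ (2⁻-pos n)) (proj₂ (archimedean (inv ε)))) ⟩
  ε ℚ.* (ι n ℚ.* 2⁻ n)        ≤⟨ *-monoʳ (ℚ.<⇒≤ 0<ε) (ι*2⁻≤1 n) ⟩
  ε ℚ.* 1ℚ                    ≡⟨ ℚ.*-identityʳ ε ⟩
  ε                           ∎)
  where
  open ℚ.≤-Reasoning
  n : ℕ
  n = proj₁ (archimedean (inv ε))

cauchy-2⁻ : IsCauchy 2⁻
cauchy-2⁻ ε 0<ε = N , λ m n p q → ∣-∣≤ (half m n p) (subst (ℚ._≤ ε) (sym (-‿swap (2⁻ m) (2⁻ n))) (half n m q))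
  where
  N : ℕ
  N = proj₁ (2⁻-small ε 0<ε)
  half : ∀ m n → N ℕ.≤ m → 2⁻ m ℚ.- 2⁻ n ℚ.≤ ε
  half m n p = p≤q+r⇒p-q≤r (2⁻ m) (2⁻ n) ε
    (subst (ℚ._≤ 2⁻ n ℚ.+ ε) (ℚ.+-identityˡ (2⁻ m))
      (ℚ.+-mono-≤ (ℚ.<⇒≤ (2⁻-pos n)) (ℚ.≤-trans (2⁻-anti p) (proj₂ (2⁻-small ε 0<ε)))))

mid-lower : ∀ {a b c} → c ℚ.≤ a → c ℚ.≤ b → c ℚ.≤ (a ℚ.+ b) ℚ.* ½
mid-lower {a} {b} {c} c≤a c≤b = subst (ℚ._≤ (a ℚ.+ b) ℚ.* ½)
  (solve 1 (λ z → (z :+ z) :* con ½ := z) refl c)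
  (*-monoˡ (ℚ.<⇒≤ 0<½) (ℚ.+-mono-≤ c≤a c≤b))
  where open +-*-Solver

0≤square : ∀ p → 0ℚ ℚ.≤ p ℚ.* p
0≤square p with ℚ.∣p∣≡p∨∣p∣≡-p p
... | inj₁ eq = subst (λ q → 0ℚ ℚ.≤ q ℚ.* q) eq (0≤* (ℚ.0≤∣p∣ p) (ℚ.0≤∣p∣ p))
... | inj₂ eq = subst (0ℚ ℚ.≤_)
  (trans (cong₂ ℚ._*_ eq eq) (solve 1 (λ x → (:- x) :* (:- x) := x :* x) refl p))
  (0≤* (ℚ.0≤∣p∣ p) (ℚ.0≤∣p∣ p))
  where open +-*-Solver

-- Halving the mesh increases the sum for 1/t, by an amount that decreases
-- geometrically.
refine : ∀ k {a b c} → 0ℚ ℚ.< c → c ℚ.≤ a → c ℚ.≤ b →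
  riemann inv k a b ℚ.≤ riemann inv (suc k) a b ×
  riemann inv (suc k) a b ℚ.≤ riemann inv k a b ℚ.+
    (((inv c ℚ.* inv c) ℚ.* ((b ℚ.- a) ℚ.* (b ℚ.- a))) ℚ.* ½) ℚ.* (2⁻ k ℚ.- 2⁻ (suc k))
refine zero {a} {b} {c} 0<c c≤a c≤b = lower , upper
  where
  open +-*-Solver
  m δ u v : ℚ
  m = (a ℚ.+ b) ℚ.* ½
  δ = (b ℚ.- a) ℚ.* ½
  u = inv m
  v = inv b
  c≤m : c ℚ.≤ m
  c≤m = mid-lower c≤a c≤b
  0<m : 0ℚ ℚ.< m
  0<m = ℚ.<-≤-trans 0<c c≤m
  0<b : 0ℚ ℚ.< b
  0<b = ℚ.<-≤-trans 0<c c≤b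
  gain : ℚ
  gain = (δ ℚ.* δ) ℚ.* (u ℚ.* v)
  0≤δ² : 0ℚ ℚ.≤ δ ℚ.* δ
  0≤δ² = 0≤square δ
  S≡ : riemann inv 0 a b ℚ.+ gain ≡ riemann inv 1 a b
  S≡ = trans
    (solve 4 (λ a b u v →
        (b :- a) :* v :+ (((b :- a) :* con ½) :* ((b :- a) :* con ½)) :* (u :* v) :=
        (b :- a) :* v :+ ((b :- a) :* con ½) :* ((u :* v) :* (b :- (a :+ b) :* con ½)))
      refl a b u v)
    (trans (cong (λ s → (b ℚ.- a) ℚ.* v ℚ.+ δ ℚ.* s) (sym (inv-diff 0<m 0<b)))
    (solve 4 (λ a b u v →
        (b :- a) :* v :+ ((b :- a) :* con ½) :* (u :- v) :=
        ((a :+ b) :* con ½ :- a) :* u :+ (b :- (a :+ b) :* con ½) :* v)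
      refl a b u v))
  lower : riemann inv 0 a b ℚ.≤ riemann inv 1 a b
  lower = subst₂ ℚ._≤_ (ℚ.+-identityʳ (riemann inv 0 a b)) S≡
    (ℚ.+-monoʳ-≤ (riemann inv 0 a b) (0≤* 0≤δ² (0≤* (inv-nonNeg 0<m) (inv-nonNeg 0<b))))
  upper : riemann inv 1 a b ℚ.≤ riemann inv 0 a b ℚ.+
    (((inv c ℚ.* inv c) ℚ.* ((b ℚ.- a) ℚ.* (b ℚ.- a))) ℚ.* ½) ℚ.* (1ℚ ℚ.- ½ ℚ.* 1ℚ)
  upper = subst₂ ℚ._≤_ S≡
    (solve 3 (λ r w d → r :+ ((d :* con ½) :* (d :* con ½)) :* w :=
        r :+ ((w :* (d :* d)) :* con ½) :* (con 1ℚ :- con ½ :* con 1ℚ))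
      refl (riemann inv 0 a b) (inv c ℚ.* inv c) (b ℚ.- a))
    (ℚ.+-monoʳ-≤ (riemann inv 0 a b) (*-monoʳ 0≤δ²
      (*-mono (inv-nonNeg 0<b) (inv-nonNeg 0<c) (inv-anti 0<c c≤m) (inv-anti 0<c c≤b))))
refine (suc k) {a} {b} {c} 0<c c≤a c≤b =
    ℚ.+-mono-≤ (proj₁ left) (proj₁ right)
  , subst (riemann inv (suc (suc k)) a b ℚ.≤_)
      (solve 6 (λ a b p q w t →
          (p :+ (w :* (((a :+ b) :* con ½ :- a) :* ((a :+ b) :* con ½ :- a))) :* con ½ :* (t :- con ½ :* t))
          :+ (q :+ (w :* ((b :- (a :+ b) :* con ½) :* (b :- (a :+ b) :* con ½))) :* con ½ :* (t :- con ½ :* t)) :=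
          (p :+ q) :+ ((w :* ((b :- a) :* (b :- a))) :* con ½) :* (con ½ :* t :- con ½ :* (con ½ :* t)))
        refl a b (riemann inv k a m) (riemann inv k m b) (inv c ℚ.* inv c) (2⁻ k))
      (ℚ.+-mono-≤ (proj₂ left) (proj₂ right))
  where
  open +-*-Solver
  m : ℚ
  m = (a ℚ.+ b) ℚ.* ½
  left = refine k {a} {m} 0<c c≤a (mid-lower c≤a c≤b)
  right = refine k {m} {b} 0<c (mid-lower c≤a c≤b) c≤b


∣-∣-half : ∀ {p q r} → p ≡ q ℚ.* ½ → ∣ q ∣ ℚ.≤ r → ∣ p ∣ ℚ.≤ r ℚ.* ½
∣-∣-half {p} {q} {r} refl h = subst (ℚ._≤ r ℚ.* ½) (sym (ℚ.∣p*q∣≡∣p∣*∣q∣ q ½))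
  (*-monoˡ (ℚ.<⇒≤ 0<½) h)

∣-∣-mean : ∀ {p q r s} → s ≡ (p ℚ.+ q) ℚ.* ½ → ∣ p ∣ ℚ.≤ r → ∣ q ∣ ℚ.≤ r → ∣ s ∣ ℚ.≤ r
∣-∣-mean {p} {q} {r} refl hp hq = subst (∣ (p ℚ.+ q) ℚ.* ½ ∣ ℚ.≤_)
  (solve 1 (λ z → (z :+ z) :* con ½ := z) refl r)
  (∣-∣-half refl (ℚ.≤-trans (ℚ.∣p+q∣≤∣p∣+∣q∣ p q) (ℚ.+-mono-≤ hp hq)))
  where open +-*-Solver

-- Moving the end points of the interval changes the sum for 1/t by an amount
-- bounded independently of the number of pieces.
perturb : ∀ k {a b a′ b′ c A w ω δ} → 0ℚ ℚ.< c →
  c ℚ.≤ a → c ℚ.≤ b → c ℚ.≤ a′ → c ℚ.≤ b′ →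
  ∣ a ∣ ℚ.≤ A → ∣ b ∣ ℚ.≤ A → ∣ b ℚ.- a ∣ ℚ.≤ w →
  ∣ (b′ ℚ.- b) ℚ.- (a′ ℚ.- a) ∣ ℚ.≤ ω → ∣ a′ ℚ.- a ∣ ℚ.≤ δ → ∣ b′ ℚ.- b ∣ ℚ.≤ δ →
  ∣ riemann inv k a b ℚ.- riemann inv k a′ b′ ∣ ℚ.≤ (inv c ℚ.* inv c) ℚ.* (δ ℚ.* w ℚ.+ A ℚ.* ω)
perturb zero {a} {b} {a′} {b′} {c} {A} {w} {ω} {δ} 0<c c≤a c≤b c≤a′ c≤b′ a≤A b≤A hw hω ha hb = begin
  ∣ (b ℚ.- a) ℚ.* v ℚ.- (b′ ℚ.- a′) ℚ.* v′ ∣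
    ≡⟨ cong ∣_∣ eq ⟩
  ∣ (v ℚ.* v′) ℚ.* (α ℚ.* (b ℚ.- a) ℚ.- a ℚ.* γ) ∣
    ≡⟨ ℚ.∣p*q∣≡∣p∣*∣q∣ (v ℚ.* v′) (α ℚ.* (b ℚ.- a) ℚ.- a ℚ.* γ) ⟩
  ∣ v ℚ.* v′ ∣ ℚ.* ∣ α ℚ.* (b ℚ.- a) ℚ.- a ℚ.* γ ∣
    ≡⟨ cong (ℚ._* ∣ α ℚ.* (b ℚ.- a) ℚ.- a ℚ.* γ ∣) (ℚ.0≤p⇒∣p∣≡p (0≤* (inv-nonNeg 0<b) (inv-nonNeg 0<b′))) ⟩
  (v ℚ.* v′) ℚ.* ∣ α ℚ.* (b ℚ.- a) ℚ.- a ℚ.* γ ∣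
    ≤⟨ *-mono (ℚ.0≤∣p∣ (α ℚ.* (b ℚ.- a) ℚ.- a ℚ.* γ)) (0≤* (inv-nonNeg 0<c) (inv-nonNeg 0<c))
         (*-mono (inv-nonNeg 0<b′) (inv-nonNeg 0<c) (inv-anti 0<c c≤b) (inv-anti 0<c c≤b′))
         (ℚ.∣p-q∣≤∣p∣+∣q∣ (α ℚ.* (b ℚ.- a)) (a ℚ.* γ)) ⟩
  (inv c ℚ.* inv c) ℚ.* (∣ α ℚ.* (b ℚ.- a) ∣ ℚ.+ ∣ a ℚ.* γ ∣)
    ≡⟨ cong ((inv c ℚ.* inv c) ℚ.*_) (cong₂ ℚ._+_ (ℚ.∣p*q∣≡∣p∣*∣q∣ α (b ℚ.- a)) (ℚ.∣p*q∣≡∣p∣*∣q∣ a γ)) ⟩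
  (inv c ℚ.* inv c) ℚ.* (∣ α ∣ ℚ.* ∣ b ℚ.- a ∣ ℚ.+ ∣ a ∣ ℚ.* ∣ γ ∣)
    ≤⟨ *-monoʳ (0≤* (inv-nonNeg 0<c) (inv-nonNeg 0<c)) (ℚ.+-mono-≤
         (*-mono (ℚ.0≤∣p∣ (b ℚ.- a)) (ℚ.≤-trans (ℚ.0≤∣p∣ α) ha) ha hw)
         (*-mono (ℚ.0≤∣p∣ γ) (ℚ.≤-trans (ℚ.0≤∣p∣ a) a≤A) a≤A hω)) ⟩
  (inv c ℚ.* inv c) ℚ.* (δ ℚ.* w ℚ.+ A ℚ.* ω) ∎
  where
  open ℚ.≤-Reasoning
  open +-*-Solver
  v v′ α γ : ℚ
  v = inv b
  v′ = inv b′
  α = a′ ℚ.- a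
  γ = (b′ ℚ.- b) ℚ.- (a′ ℚ.- a)
  0<b : 0ℚ ℚ.< b
  0<b = ℚ.<-≤-trans 0<c c≤b
  0<b′ : 0ℚ ℚ.< b′
  0<b′ = ℚ.<-≤-trans 0<c c≤b′
  eq : (b ℚ.- a) ℚ.* v ℚ.- (b′ ℚ.- a′) ℚ.* v′ ≡ (v ℚ.* v′) ℚ.* (α ℚ.* (b ℚ.- a) ℚ.- a ℚ.* γ)
  eq = sym (trans
    (solve 6 (λ a b a′ b′ v v′ →
        (v :* v′) :* ((a′ :- a) :* (b :- a) :- a :* ((b′ :- b) :- (a′ :- a))) :=
        (a′ :* v′) :* (b :* v) :- (a :* v) :* (b′ :* v′))
      refl a b a′ b′ v v′)
    (trans (cong₂ (λ s t → (a′ ℚ.* v′) ℚ.* s ℚ.- (a ℚ.* v) ℚ.* t) (inv-inverseʳ 0<b) (inv-inverseʳ 0<b′))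
    (trans
      (solve 4 (λ a a′ v v′ →
          (a′ :* v′) :* con 1ℚ :- (a :* v) :* con 1ℚ := (con 1ℚ :- a :* v) :- (con 1ℚ :- a′ :* v′))
        refl a a′ v v′)
      (trans (cong₂ (λ s t → (s ℚ.- a ℚ.* v) ℚ.- (t ℚ.- a′ ℚ.* v′)) (sym (inv-inverseʳ 0<b)) (sym (inv-inverseʳ 0<b′)))
        (solve 6 (λ a b a′ b′ v v′ →
            (b :* v :- a :* v) :- (b′ :* v′ :- a′ :* v′) := (b :- a) :* v :- (b′ :- a′) :* v′)
          refl a b a′ b′ v v′)))))
perturb (suc k) {a} {b} {a′} {b′} {c} {A} {w} {ω} {δ} 0<c c≤a c≤b c≤a′ c≤b′ a≤A b≤A hw hω ha hb =
  subst₂ ℚ._≤_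
    (cong ∣_∣ (solve 4 (λ p q p′ q′ → (p :- p′) :+ (q :- q′) := (p :+ q) :- (p′ :+ q′)) refl
      (riemann inv k a m) (riemann inv k m b) (riemann inv k a′ m′) (riemann inv k m′ b′)))
    (solve 5 (λ e d w A o →
        e :* (d :* (w :* con ½) :+ A :* (o :* con ½)) :+ e :* (d :* (w :* con ½) :+ A :* (o :* con ½)) :=
        e :* (d :* w :+ A :* o))
      refl (inv c ℚ.* inv c) δ w A ω)
    (ℚ.≤-trans
      (ℚ.∣p+q∣≤∣p∣+∣q∣ (riemann inv k a m ℚ.- riemann inv k a′ m′) (riemann inv k m b ℚ.- riemann inv k m′ b′))
      (ℚ.+-mono-≤
        (perturb k 0<c c≤a c≤m c≤a′ c≤m′ a≤A m≤A
          (∣-∣-half (solve 2 (λ a b → (a :+ b) :* con ½ :- a := (b :- a) :* con ½) refl a b) hw)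
          (∣-∣-half (solve 4 (λ a b a′ b′ →
            ((a′ :+ b′) :* con ½ :- (a :+ b) :* con ½) :- (a′ :- a) := ((b′ :- b) :- (a′ :- a)) :* con ½) refl a b a′ b′) hω)
          ha hm)
        (perturb k 0<c c≤m c≤b c≤m′ c≤b′ m≤A b≤A
          (∣-∣-half (solve 2 (λ a b → b :- (a :+ b) :* con ½ := (b :- a) :* con ½) refl a b) hw)
          (∣-∣-half (solve 4 (λ a b a′ b′ →
            (b′ :- b) :- ((a′ :+ b′) :* con ½ :- (a :+ b) :* con ½) := ((b′ :- b) :- (a′ :- a)) :* con ½) refl a b a′ b′) hω)
          hm hb)))
  where
  open +-*-Solver
  m m′ : ℚ
  m = (a ℚ.+ b) ℚ.* ½
  m′ = (a′ ℚ.+ b′) ℚ.* ½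
  c≤m : c ℚ.≤ m
  c≤m = mid-lower c≤a c≤b
  c≤m′ : c ℚ.≤ m′
  c≤m′ = mid-lower c≤a′ c≤b′
  m≤A : ∣ m ∣ ℚ.≤ A
  m≤A = ∣-∣-mean refl a≤A b≤A
  hm : ∣ m′ ℚ.- m ∣ ℚ.≤ δ
  hm = ∣-∣-mean (solve 4 (λ a b a′ b′ →
    (a′ :+ b′) :* con ½ :- (a :+ b) :* con ½ := ((a′ :- a) :+ (b′ :- b)) :* con ½) refl a b a′ b′) ha hb

refine-≤′ : ∀ {m n} → m ℕ.≤′ n → ∀ {a b c} → 0ℚ ℚ.< c → c ℚ.≤ a → c ℚ.≤ b →
  riemann inv m a b ℚ.≤ riemann inv n a b ×
  riemann inv n a b ℚ.≤ riemann inv m a b ℚ.+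
    (((inv c ℚ.* inv c) ℚ.* ((b ℚ.- a) ℚ.* (b ℚ.- a))) ℚ.* ½) ℚ.* (2⁻ m ℚ.- 2⁻ n)
refine-≤′ {m} ℕ.≤′-refl {a} {b} {c} _ _ _ = ℚ.≤-refl ,
  ℚ.≤-reflexive (solve 3 (λ r d t → r := r :+ d :* (t :- t)) refl (riemann inv m a b)
    (((inv c ℚ.* inv c) ℚ.* ((b ℚ.- a) ℚ.* (b ℚ.- a))) ℚ.* ½) (2⁻ m))
  where open +-*-Solver
refine-≤′ {m} (ℕ.≤′-step {n} m≤n) {a} {b} {c} 0<c c≤a c≤b =
    ℚ.≤-trans (proj₁ ih) (proj₁ step)
  , ℚ.≤-trans (proj₂ step) (ℚ.≤-trans (ℚ.+-monoˡ-≤ (D ℚ.* (2⁻ n ℚ.- 2⁻ (suc n))) (proj₂ ih))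
      (ℚ.≤-reflexive (solve 5 (λ r d s t t′ → (r :+ d :* (s :- t)) :+ d :* (t :- t′) := r :+ d :* (s :- t′))
        refl (riemann inv m a b) D (2⁻ m) (2⁻ n) (2⁻ (suc n)))))
  where
  open +-*-Solver
  D : ℚ
  D = ((inv c ℚ.* inv c) ℚ.* ((b ℚ.- a) ℚ.* (b ℚ.- a))) ℚ.* ½
  ih = refine-≤′ m≤n {a} {b} {c} 0<c c≤a c≤b
  step = refine n {a} {b} {c} 0<c c≤a c≤b

refine-≤ : ∀ m n → m ℕ.≤ n → ∀ {b c B} → 0ℚ ℚ.< c → c ℚ.≤ 1ℚ → c ℚ.≤ b → ∣ b ℚ.- 1ℚ ∣ ℚ.≤ B →
  ∣ riemann inv n 1ℚ b ℚ.- riemann inv m 1ℚ b ∣ ℚ.≤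
    ((inv c ℚ.* inv c) ℚ.* (B ℚ.* B)) ℚ.* ∣ 2⁻ m ℚ.- 2⁻ n ∣
refine-≤ m n m≤n {b} {c} {B} 0<c c≤1 c≤b b≤B = begin
  ∣ Rₙ ℚ.- Rₘ ∣             ≡⟨ ℚ.0≤p⇒∣p∣≡p (subst (ℚ._≤ Rₙ ℚ.- Rₘ) (ℚ.+-inverseʳ Rₘ) (ℚ.+-monoˡ-≤ (ℚ.- Rₘ) (proj₁ r))) ⟩
  Rₙ ℚ.- Rₘ                 ≤⟨ p≤q+r⇒p-q≤r Rₙ Rₘ (D ℚ.* (2⁻ m ℚ.- 2⁻ n)) (proj₂ r) ⟩
  D ℚ.* (2⁻ m ℚ.- 2⁻ n)     ≤⟨ *-mono 0≤Δ 0≤K D≤K (p≤∣p∣ (2⁻ m ℚ.- 2⁻ n)) ⟩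
  K ℚ.* ∣ 2⁻ m ℚ.- 2⁻ n ∣   ∎
  where
  open ℚ.≤-Reasoning
  Rₘ Rₙ e D K : ℚ
  Rₘ = riemann inv m 1ℚ b
  Rₙ = riemann inv n 1ℚ b
  e = b ℚ.- 1ℚ
  D = ((inv c ℚ.* inv c) ℚ.* (e ℚ.* e)) ℚ.* ½
  K = (inv c ℚ.* inv c) ℚ.* (B ℚ.* B)
  r = refine-≤′ (ℕ.≤⇒≤′ m≤n) {1ℚ} {b} {c} 0<c c≤1 c≤b
  0≤u² : 0ℚ ℚ.≤ inv c ℚ.* inv c
  0≤u² = 0≤* (inv-nonNeg 0<c) (inv-nonNeg 0<c)
  0≤Δ : 0ℚ ℚ.≤ 2⁻ m ℚ.- 2⁻ n
  0≤Δ = subst (ℚ._≤ 2⁻ m ℚ.- 2⁻ n) (ℚ.+-inverseʳ (2⁻ n)) (ℚ.+-monoˡ-≤ (ℚ.- 2⁻ n) (2⁻-anti m≤n))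
  0≤K : 0ℚ ℚ.≤ K
  0≤K = 0≤* 0≤u² (0≤square B)
  e²≤B² : e ℚ.* e ℚ.≤ B ℚ.* B
  e²≤B² = ℚ.≤-trans (p≤∣p∣ (e ℚ.* e)) (subst (ℚ._≤ B ℚ.* B) (sym (ℚ.∣p*q∣≡∣p∣*∣q∣ e e))
    (*-mono (ℚ.0≤∣p∣ e) (ℚ.≤-trans (ℚ.0≤∣p∣ e) b≤B) b≤B b≤B))
  D≤K : D ℚ.≤ K
  D≤K = subst (D ℚ.≤_) (ℚ.*-identityʳ K)
    (*-mono (ℚ.<⇒≤ 0<½) 0≤K (*-monoʳ 0≤u² e²≤B²) (ℚ.≤ᵇ⇒≤ {½} {1ℚ} _))

refine-∣-∣ : ∀ m n {b c B} → 0ℚ ℚ.< c → c ℚ.≤ 1ℚ → c ℚ.≤ b → ∣ b ℚ.- 1ℚ ∣ ℚ.≤ B →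
  ∣ riemann inv m 1ℚ b ℚ.- riemann inv n 1ℚ b ∣ ℚ.≤
    ((inv c ℚ.* inv c) ℚ.* (B ℚ.* B)) ℚ.* ∣ 2⁻ m ℚ.- 2⁻ n ∣
refine-∣-∣ m n {b} {c} {B} 0<c c≤1 c≤b b≤B with ℕ.≤-total m n
... | inj₁ m≤n = subst (ℚ._≤ ((inv c ℚ.* inv c) ℚ.* (B ℚ.* B)) ℚ.* ∣ 2⁻ m ℚ.- 2⁻ n ∣)
  (∣-∣-swap (riemann inv n 1ℚ b) (riemann inv m 1ℚ b)) (refine-≤ m n m≤n 0<c c≤1 c≤b b≤B)
... | inj₂ n≤m = subst (λ s → ∣ riemann inv m 1ℚ b ℚ.- riemann inv n 1ℚ b ∣ ℚ.≤
    ((inv c ℚ.* inv c) ℚ.* (B ℚ.* B)) ℚ.* s)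
  (∣-∣-swap (2⁻ n) (2⁻ m)) (refine-≤ n m n≤m 0<c c≤1 c≤b b≤B)

-- ln x = ∫₁ˣ dt/t, as the limit over k of the Riemann sums with 2^k pieces.
-- The upper end point x is replaced by its k-th rational approximation, and
-- for x < 1 the signed sum accounts for the orientation of the integral.
ln : (x : ℝ) → 0ℝ < x → ℝ
ln x 0<x = mkℝ (λ k → riemann inv k 1ℚ (seq x k))
  (cauchy-lipschitz x (mkℝ 2⁻ cauchy-2⁻) (λ k → riemann inv k 1ℚ (seq x k)) K 0<K (N₁ ℕ.⊔ N₂) bound)
  where
  px = pos-lower {x} 0<x
  bx = cauchy-bounded x
  c₀ c B A u² K : ℚ
  c₀ = proj₁ px
  c = c₀ ℚ.⊓ 1ℚ
  B = proj₁ bx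
  A = B ℚ.+ 1ℚ
  u² = inv c ℚ.* inv c
  K = u² ℚ.* (A ℚ.+ A) ℚ.+ u² ℚ.* (A ℚ.* A)
  N₁ N₂ : ℕ
  N₁ = proj₁ (proj₂ (proj₂ px))
  N₂ = proj₁ (proj₂ (proj₂ bx))
  0<c : 0ℚ ℚ.< c
  0<c with ℚ.⊓-sel c₀ 1ℚ
  ... | inj₁ eq = subst (0ℚ ℚ.<_) (sym eq) (proj₁ (proj₂ px))
  ... | inj₂ eq = subst (0ℚ ℚ.<_) (sym eq) 0<1
  0<A : 0ℚ ℚ.< A
  0<A = 0<+ (proj₁ (proj₂ bx)) (ℚ.<⇒≤ 0<1)
  0<u² : 0ℚ ℚ.< u²
  0<u² = 0<* (inv-pos 0<c) (inv-pos 0<c)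
  0≤K₂ : 0ℚ ℚ.≤ u² ℚ.* (A ℚ.* A)
  0≤K₂ = ℚ.<⇒≤ (0<* 0<u² (0<* 0<A 0<A))
  0≤K₁ : 0ℚ ℚ.≤ u² ℚ.* (A ℚ.+ A)
  0≤K₁ = ℚ.<⇒≤ (0<* 0<u² (0<+ 0<A (ℚ.<⇒≤ 0<A)))
  0<K : 0ℚ ℚ.< K
  0<K = 0<+ (0<* 0<u² (0<+ 0<A (ℚ.<⇒≤ 0<A))) 0≤K₂
  1≤A : ∣ 1ℚ ∣ ℚ.≤ A
  1≤A = subst (ℚ._≤ A) (ℚ.+-identityˡ 1ℚ) (ℚ.+-monoˡ-≤ 1ℚ (ℚ.<⇒≤ (proj₁ (proj₂ bx))))
  close : ∀ m n p q → c₀ ℚ.≤ p → c₀ ℚ.≤ q → ∣ p ∣ ℚ.≤ B → ∣ q ∣ ℚ.≤ B →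
    ∣ riemann inv m 1ℚ p ℚ.- riemann inv n 1ℚ q ∣ ℚ.≤ K ℚ.* (∣ p ℚ.- q ∣ ℚ.+ ∣ 2⁻ m ℚ.- 2⁻ n ∣)
  close m n p q c≤p c≤q p≤B q≤B = begin
    ∣ riemann inv m 1ℚ p ℚ.- riemann inv n 1ℚ q ∣
      ≤⟨ ∣-∣-triangle (riemann inv m 1ℚ p) (riemann inv m 1ℚ q) (riemann inv n 1ℚ q) ⟩
    ∣ riemann inv m 1ℚ p ℚ.- riemann inv m 1ℚ q ∣ ℚ.+ ∣ riemann inv m 1ℚ q ℚ.- riemann inv n 1ℚ q ∣
      ≤⟨ ℚ.+-mono-≤
           (perturb m {1ℚ} {p} {1ℚ} {q} {c} {A} {A} {Δ} {Δ} 0<c c≤1 (≤c₀ c≤p) c≤1 (≤c₀ c≤q)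
             1≤A (ℚ.≤-trans p≤B B≤A) (-1≤A p≤B)
             (ℚ.≤-reflexive (cong ∣_∣ (ℚ.+-identityʳ (q ℚ.- p)))) (ℚ.0≤∣p∣ (q ℚ.- p)) ℚ.≤-refl)
           (refine-∣-∣ m n {q} {c} {A} 0<c c≤1 (≤c₀ c≤q) (-1≤A q≤B)) ⟩
    u² ℚ.* (Δ ℚ.* A ℚ.+ A ℚ.* Δ) ℚ.+ (u² ℚ.* (A ℚ.* A)) ℚ.* Θ
      ≡⟨ cong (λ s → u² ℚ.* (s ℚ.* A ℚ.+ A ℚ.* s) ℚ.+ (u² ℚ.* (A ℚ.* A)) ℚ.* Θ) (∣-∣-swap q p) ⟩
    u² ℚ.* (∣ p ℚ.- q ∣ ℚ.* A ℚ.+ A ℚ.* ∣ p ℚ.- q ∣) ℚ.+ (u² ℚ.* (A ℚ.* A)) ℚ.* Θ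
      ≤⟨ ℚ.+-mono-≤ (ℚ.≤-reflexive
             (solve 3 (λ u s A → u :* (s :* A :+ A :* s) := (u :* (A :+ A)) :* s) refl u² ∣ p ℚ.- q ∣ A))
           ℚ.≤-refl ⟩
    (u² ℚ.* (A ℚ.+ A)) ℚ.* ∣ p ℚ.- q ∣ ℚ.+ (u² ℚ.* (A ℚ.* A)) ℚ.* Θ
      ≤⟨ ℚ.+-mono-≤ (*-monoˡ (ℚ.0≤∣p∣ (p ℚ.- q)) (≤+ʳ (u² ℚ.* (A ℚ.+ A)) 0≤K₂))
                    (*-monoˡ (ℚ.0≤∣p∣ (2⁻ m ℚ.- 2⁻ n)) (≤+ˡ (u² ℚ.* (A ℚ.* A)) 0≤K₁)) ⟩
    K ℚ.* ∣ p ℚ.- q ∣ ℚ.+ K ℚ.* Θ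
      ≡⟨ ℚ.*-distribˡ-+ K ∣ p ℚ.- q ∣ Θ ⟨
    K ℚ.* (∣ p ℚ.- q ∣ ℚ.+ Θ) ∎
    where
    open ℚ.≤-Reasoning
    open +-*-Solver
    Δ Θ : ℚ
    Δ = ∣ q ℚ.- p ∣
    Θ = ∣ 2⁻ m ℚ.- 2⁻ n ∣
    c≤1 : c ℚ.≤ 1ℚ
    c≤1 = ℚ.p⊓q≤q c₀ 1ℚ
    ≤c₀ : ∀ {r} → c₀ ℚ.≤ r → c ℚ.≤ r
    ≤c₀ = ℚ.≤-trans (ℚ.p⊓q≤p c₀ 1ℚ)
    B≤A : B ℚ.≤ A
    B≤A = ≤+ʳ B (ℚ.<⇒≤ 0<1)
    -1≤A : ∀ {r} → ∣ r ∣ ℚ.≤ B → ∣ r ℚ.- 1ℚ ∣ ℚ.≤ A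
    -1≤A {r} h = ℚ.≤-trans (ℚ.∣p-q∣≤∣p∣+∣q∣ r 1ℚ) (ℚ.+-monoˡ-≤ 1ℚ h)
  bound : ∀ m n → N₁ ℕ.⊔ N₂ ℕ.≤ m → N₁ ℕ.⊔ N₂ ℕ.≤ n →
    ∣ riemann inv m 1ℚ (seq x m) ℚ.- riemann inv n 1ℚ (seq x n) ∣ ℚ.≤
      K ℚ.* (∣ seq x m ℚ.- seq x n ∣ ℚ.+ ∣ 2⁻ m ℚ.- 2⁻ n ∣)
  bound m n p q = close m n (seq x m) (seq x n)
    (proj₂ (proj₂ (proj₂ px)) m (ℕ.m⊔n≤o⇒m≤o N₁ N₂ p))
    (proj₂ (proj₂ (proj₂ px)) n (ℕ.m⊔n≤o⇒m≤o N₁ N₂ q))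
    (proj₂ (proj₂ (proj₂ bx)) m (ℕ.m⊔n≤o⇒n≤o N₁ N₂ p))
    (proj₂ (proj₂ (proj₂ bx)) n (ℕ.m⊔n≤o⇒n≤o N₁ N₂ q))

data Rec : ℕ → Set where
  zero : Rec 0
  suc  : Rec 1
  proj : ∀ {n} → Fin n → Rec n
  comp : ∀ {m n} → Rec m → Vec (Rec n) m → Rec n
  prec : ∀ {n} → Rec n → Rec (suc (suc n)) → Rec (suc n)
  min  : ∀ {n} → Rec (suc n) → Rec n

infix 4 _[_]⇓_ _[_]⇓*_

mutual
  -- c [ xs ]⇓ y: the function with code c is defined at xs, with value y.
  data _[_]⇓_ : ∀ {n} → Rec n → Vec ℕ n → ℕ → Set where
    zero⇓  : zero [ [] ]⇓ 0
    suc⇓   : ∀ {x} → suc [ x ∷ [] ]⇓ suc x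
    proj⇓  : ∀ {n} {i : Fin n} {xs} → proj i [ xs ]⇓ lookup xs i
    comp⇓  : ∀ {m n} {f : Rec m} {gs : Vec (Rec n) m} {xs ys z} →
             gs [ xs ]⇓* ys → f [ ys ]⇓ z → comp f gs [ xs ]⇓ z
    prec₀⇓ : ∀ {n} {f : Rec n} {g xs y} →
             f [ xs ]⇓ y → prec f g [ 0 ∷ xs ]⇓ y
    precₛ⇓ : ∀ {n} {f : Rec n} {g k xs y z} →
             prec f g [ k ∷ xs ]⇓ y → g [ k ∷ y ∷ xs ]⇓ z → prec f g [ suc k ∷ xs ]⇓ z
    min⇓   : ∀ {n} {f : Rec (suc n)} {xs k} →
             f [ k ∷ xs ]⇓ 0 →
             (∀ j → j ℕ.< k → ∃[ y ] f [ j ∷ xs ]⇓ suc y) →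
             min f [ xs ]⇓ k

  data _[_]⇓*_ : ∀ {m n} → Vec (Rec n) m → Vec ℕ n → Vec ℕ m → Set where
    []  : ∀ {n} {xs : Vec ℕ n} → [] [ xs ]⇓* []
    _∷_ : ∀ {m n} {f : Rec n} {fs : Vec (Rec n) m} {xs y ys} →
          f [ xs ]⇓ y → fs [ xs ]⇓* ys → (f ∷ fs) [ xs ]⇓* (y ∷ ys)

Computable₂ : (ℕ → ℕ → ℕ) → Set
Computable₂ f = ∃[ c ] (∀ m n → c [ m ∷ n ∷ [] ]⇓ f m n)

String : Set
String = List Bool

2^ℕ : Set
2^ℕ = ℕ → Bool

infixl 8 _↾_

_↾_ : 2^ℕ → ℕ → String
ω ↾ n = applyUpTo ω n

infix 4 _∈[_]

_∈[_] : 2^ℕ → String → Set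
ω ∈[ σ ] = ω ↾ length σ ≡ σ

strings : ℕ → List String
strings zero    = [] ∷ []
strings (suc n) = concatMap (λ σ → (σ ∷ʳ false) ∷ (σ ∷ʳ true) ∷ []) (strings n)

-- Bijective base-2 numeration, a bijection between strings and ℕ.
⌜_⌝ : String → ℕ
⌜ [] ⌝        = 0
⌜ false ∷ σ ⌝ = 1 ℕ.+ 2 ℕ.* ⌜ σ ⌝
⌜ true  ∷ σ ⌝ = 2 ℕ.+ 2 ℕ.* ⌜ σ ⌝

⌜_⌝ℤ : ℤ → ℕ
⌜ + n ⌝ℤ      = 2 ℕ.* n
⌜ -[1+ n ] ⌝ℤ = 1 ℕ.+ 2 ℕ.* n

-- A probability measure is given by its values ν(σ) on the cylinders.
record Measure : Set where
  field
    val      : String → ℝ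
    nonneg   : ∀ σ → 0ℝ ≤ val σ
    total    : val [] ≈ 1ℝ
    additive : ∀ σ → val σ ≈ val (σ ∷ʳ false) + val (σ ∷ʳ true)

open Measure public

-- A computable sequence of rationals q σ n approximates ν(σ) to within
-- 2^(-n), uniformly in σ; rationals are computed as numerator and denominator.
ComputableMeasure : Measure → Set
ComputableMeasure ν = Σ (String → ℕ → ℚ) λ q →
  (∃[ c ] (∀ σ n → c [ ⌜ σ ⌝ ∷ n ∷ [] ]⇓ ⌜ ↥ q σ n ⌝ℤ)) ×
  (∃[ d ] (∀ σ n → d [ ⌜ σ ⌝ ∷ n ∷ [] ]⇓ ↧ₙ q σ n)) ×
  (∀ (σ : String) (n : ℕ) →
     fromℚ (q σ n ℚ.- 2⁻ n) ≤ val ν σ × val ν σ ≤ fromℚ (q σ n ℚ.+ 2⁻ n))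

FullSupport : Measure → Set
FullSupport ν = ∀ σ → 0ℝ < val ν σ

∑ : {A : Set} → List A → (A → ℝ) → ℝ
∑ as f = foldr (λ a s → f a + s) 0ℝ as

-- 𝔼 ν n g is the ν-expectation of ω ↦ g (ω ↾ n).
𝔼 : Measure → ℕ → (String → ℝ) → ℝ
𝔼 ν n g = ∑ (strings n) (λ σ → val ν σ * g σ)

-- The relation ν ≪_kl μ: the numbers 𝔼_ν ln (ν(ω↾n) / μ(ω↾n)) are bounded above.
KLBounded : (ν μ : Measure) → FullSupport ν → FullSupport μ → Set
KLBounded ν μ ν>0 μ>0 = ∃[ C ] (∀ n → 𝔼 ν n logRatio ≤ C)
  where
  logRatio : String → ℝ
  logRatio σ = ln (val ν σ / val μ σ ⟨ μ>0 σ ⟩) (/-pos {val ν σ} {val μ σ} (ν>0 σ) (μ>0 σ))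

-- The open set ⋃ₖ [U k]
OpenSet : Set
OpenSet = ℕ → String

infix 4 _∈_

_∈_ : 2^ℕ → OpenSet → Set
ω ∈ U = ∃[ k ] ω ∈[ U k ]

-- ν ([σ₁] ∪ … ∪ [σₙ]), computed at the maximal length L of the σᵢ: at that
-- level every cylinder lies inside the union or is disjoint from it.
measure-⋃ : Measure → List String → ℝ
measure-⋃ ν σs = ∑ (strings L) λ τ →
  if does (any? (λ σ → prefix? Bool._≟_ σ τ) σs) then val ν τ else 0ℝ
  where
  L : ℕ
  L = foldr (λ σ l → length σ ℕ.⊔ l) 0 σs

-- ν(U) ≤ q.  The measure of an open set is the supremum of the measures of
-- the finite partial unions.
Measure≤ : Measure → OpenSet → ℚ → Set
Measure≤ ν U q = ∀ k → measure-⋃ ν (applyUpTo U k) ≤ fromℚ q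

-- A computable sequence of c.e. open sets, given uniformly by a computable
-- double sequence of strings.
ComputableOpens : (ℕ → OpenSet) → Set
ComputableOpens U = Computable₂ (λ n k → ⌜ U n k ⌝)

MLR : Measure → 2^ℕ → Set
MLR ν ω = ∀ (U : ℕ → OpenSet) → ComputableOpens U →
  (∀ n → Measure≤ ν (U n) (2⁻ n)) → ¬ (∀ n → ω ∈ U n)

_≪MLR_ : Measure → Measure → Set
ν ≪MLR μ = ∀ ω → MLR ν ω → MLR μ ω

{-# OPTIONS --safe #-}
-- For x > 0 the right-endpoint sums of ∫₁ˣ dt/t satisfy R_j(x) ≥ 1 + j/2 - (2^(j+1) - 1)/x
-- and increase with j.  With x = ν(σ)/μ(σ), summing over the strings σ of a given length,
-- using the bound for j on a clopen set A and the one for 0 off A, gives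
--   (j/2) ν(A) ≤ 𝔼_ν ln (ν/μ) + 1 + 2^(j+1) μ(A).
-- Hence μ(U_n) ≤ 2^(-n) forces ν(U_n) = O(1/n), and V_m = U_(1 + K 2^m) is a ν-test for
-- some constant K.
module Submission where

open import Defs

open import Data.Bool.Base using (Bool; true; false; if_then_else_)
import Data.Bool.Properties as Bool
open import Data.Fin.Base using (zero; suc)
open import Data.List.Base using (List; []; _∷_; _∷ʳ_; applyUpTo; concatMap; foldr; length)
open import Data.List.Relation.Unary.All using (All; []; _∷_)
open import Data.List.Relation.Unary.Any using (any?)
open import Data.List.Relation.Binary.Prefix.Heterogeneous.Properties using (prefix?)
open import Data.Nat.Base as ℕ using (ℕ; zero; suc)
import Data.Nat.Properties as ℕ
open import Data.Product.Base using (∃-syntax; _,_; proj₁; proj₂)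
open import Data.Rational.Base as ℚ using (ℚ; 0ℚ; 1ℚ; ½; ∣_∣)
import Data.Rational.Properties as ℚ
open import Data.Rational.Solver using (module +-*-Solver)
open import Data.Sum.Base using (inj₁; inj₂)
open import Data.Vec.Base using ([]; _∷_)
open import Relation.Binary.PropositionalEquality
  using (_≡_; refl; sym; trans; cong; cong₂; subst; subst₂; module ≡-Reasoning)
open import Relation.Nullary using (does)

open +-*-Solver

-- Powers of two and natural numbers as rationals.

2⁺ : ℕ → ℚ
2⁺ zero    = 1ℚ
2⁺ (suc n) = 2⁺ n ℚ.+ 2⁺ n

2⁻*2⁺≡1 : ∀ n → 2⁻ n ℚ.* 2⁺ n ≡ 1ℚ
2⁻*2⁺≡1 zero    = refl
2⁻*2⁺≡1 (suc n) = trans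
  (solve 2 (λ s t → (con ½ :* s) :* (t :+ t) := s :* t) refl (2⁻ n) (2⁺ n))
  (2⁻*2⁺≡1 n)

1≤2⁺ : ∀ n → 1ℚ ℚ.≤ 2⁺ n
1≤2⁺ zero    = ℚ.≤-refl
1≤2⁺ (suc n) = ℚ.≤-trans (1≤2⁺ n) (≤+ʳ (2⁺ n) (ℚ.≤-trans (ℚ.<⇒≤ 0<1) (1≤2⁺ n)))

0≤2⁺ : ∀ n → 0ℚ ℚ.≤ 2⁺ n
0≤2⁺ n = ℚ.≤-trans (ℚ.<⇒≤ 0<1) (1≤2⁺ n)

ι-+ : ∀ m n → ι (m ℕ.+ n) ≡ ι m ℚ.+ ι n
ι-+ zero    n = sym (ℚ.+-identityˡ (ι n))
ι-+ (suc m) n = trans (cong (1ℚ ℚ.+_) (ι-+ m n)) (sym (ℚ.+-assoc 1ℚ (ι m) (ι n)))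

-- Lower bounds for the Riemann sums of 1/t.

0<⊓ : ∀ {p q} → 0ℚ ℚ.< p → 0ℚ ℚ.< q → 0ℚ ℚ.< p ℚ.⊓ q
0<⊓ {p} {q} 0<p 0<q with ℚ.⊓-sel p q
... | inj₁ eq = subst (0ℚ ℚ.<_) (sym eq) 0<p
... | inj₂ eq = subst (0ℚ ℚ.<_) (sym eq) 0<q

-- Halving a piece adds the square of half its length divided by the product of its midpoint and its
-- right end. This is nonnegative for either orientation, so b < a is allowed.
riemann-inv-mono : ∀ {j k} → j ℕ.≤ k → ∀ {a b} → 0ℚ ℚ.< a → 0ℚ ℚ.< b →
  riemann inv j a b ℚ.≤ riemann inv k a b
riemann-inv-mono j≤k {a} {b} 0<a 0<b =
  proj₁ (refine-≤′ (ℕ.≤⇒≤′ j≤k) {a} {b} {a ℚ.⊓ b} (0<⊓ 0<a 0<b) (ℚ.p⊓q≤p a b) (ℚ.p⊓q≤q a b))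

inv-≤-double : ∀ {m x} → 0ℚ ℚ.< m → 0ℚ ℚ.< x → x ℚ.≤ m ℚ.+ m → inv m ℚ.≤ inv x ℚ.+ inv x
inv-≤-double {m} {x} 0<m 0<x x≤2m = subst₂ ℚ._≤_
  (trans (solve 3 (λ u v x → (u :* v) :* x := u :* (x :* v)) refl (inv m) (inv x) x)
    (trans (cong (inv m ℚ.*_) (inv-inverseʳ 0<x)) (ℚ.*-identityʳ (inv m))))
  (trans (solve 3 (λ u v m → (u :* v) :* (m :+ m) := (m :* u) :* (v :+ v)) refl (inv m) (inv x) m)
    (trans (cong (ℚ._* (inv x ℚ.+ inv x)) (inv-inverseʳ 0<m)) (ℚ.*-identityˡ (inv x ℚ.+ inv x))))
  (*-monoʳ (0≤* (inv-nonNeg 0<m) (inv-nonNeg 0<x)) x≤2m)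

-- Induction on j, splitting at the midpoint m of 1 and x. The left half is the induction hypothesis
-- at m, where 1/m ≤ 2/x; the right half is at least its one-piece sum (x - m)/x = 1/2 - 1/(2x).
-- Each refinement thus gains 1/2 and doubles the coefficient of 1/x, up to a constant.
riemann-inv-lower : ∀ j {x} → 0ℚ ℚ.< x →
  1ℚ ℚ.+ ι j ℚ.* ½ ℚ.≤ riemann inv j 1ℚ x ℚ.+ (2⁺ (suc j) ℚ.- 1ℚ) ℚ.* inv x
riemann-inv-lower zero {x} 0<x = ℚ.≤-reflexive (trans (sym (inv-inverseʳ 0<x))
  (solve 2 (λ x u → x :* u := (x :- con 1ℚ) :* u :+ ((con 1ℚ :+ con 1ℚ) :- con 1ℚ) :* u) refl x (inv x)))
riemann-inv-lower (suc j) {x} 0<x = begin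
  1ℚ ℚ.+ (1ℚ ℚ.+ ι j) ℚ.* ½
    ≡⟨ solve 1 (λ i → con 1ℚ :+ (con 1ℚ :+ i) :* con ½ := (con 1ℚ :+ i :* con ½) :+ con ½ :* con 1ℚ) refl (ι j) ⟩
  (1ℚ ℚ.+ ι j ℚ.* ½) ℚ.+ ½ ℚ.* 1ℚ
    ≡⟨ cong (λ s → (1ℚ ℚ.+ ι j ℚ.* ½) ℚ.+ ½ ℚ.* s) (inv-inverseʳ 0<x) ⟨
  (1ℚ ℚ.+ ι j ℚ.* ½) ℚ.+ ½ ℚ.* (x ℚ.* u)
    ≤⟨ ℚ.+-monoˡ-≤ (½ ℚ.* (x ℚ.* u)) (ℚ.≤-trans (riemann-inv-lower j 0<m)
         (ℚ.+-monoʳ-≤ R₁ (*-monoʳ 0≤t (inv-≤-double 0<m 0<x x≤2m)))) ⟩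
  (R₁ ℚ.+ t ℚ.* (u ℚ.+ u)) ℚ.+ ½ ℚ.* (x ℚ.* u)
    ≡⟨ solve 4 (λ r s u x →
         (r :+ (s :- con 1ℚ) :* (u :+ u)) :+ con ½ :* (x :* u) :=
         (r :+ (x :- (con 1ℚ :+ x) :* con ½) :* u) :+ ((s :+ s) :- (con 1ℚ :+ con ½)) :* u)
       refl R₁ (2⁺ (suc j)) u x ⟩
  (R₁ ℚ.+ (x ℚ.- m) ℚ.* u) ℚ.+ (2⁺ (suc (suc j)) ℚ.- (1ℚ ℚ.+ ½)) ℚ.* u
    -- The coefficient obtained is 2^(j+2) - 3/2; rounding it up to 2^(j+2) - 1 restores the shape
    -- of the bound.
    ≤⟨ ℚ.+-mono-≤ (ℚ.+-monoʳ-≤ R₁ (riemann-inv-mono {0} {j} ℕ.z≤n 0<m 0<x))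
         (*-monoˡ (inv-nonNeg 0<x) (ℚ.+-monoʳ-≤ (2⁺ (suc (suc j)))
           (ℚ.neg-antimono-≤ (≤+ʳ 1ℚ (ℚ.<⇒≤ 0<½))))) ⟩
  (R₁ ℚ.+ riemann inv j m x) ℚ.+ (2⁺ (suc (suc j)) ℚ.- 1ℚ) ℚ.* u ∎
  where
  open ℚ.≤-Reasoning
  m u t R₁ : ℚ
  m = (1ℚ ℚ.+ x) ℚ.* ½
  u = inv x
  t = 2⁺ (suc j) ℚ.- 1ℚ
  R₁ = riemann inv j 1ℚ m
  0<m : 0ℚ ℚ.< m
  0<m = 0<* (0<+ 0<1 (ℚ.<⇒≤ 0<x)) 0<½
  0≤t : 0ℚ ℚ.≤ t
  0≤t = subst (ℚ._≤ t) (ℚ.+-inverseʳ 1ℚ) (ℚ.+-monoˡ-≤ (ℚ.- 1ℚ) (1≤2⁺ (suc j)))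
  x≤2m : x ℚ.≤ m ℚ.+ m
  x≤2m = subst (x ℚ.≤_)
    (solve 1 (λ x → con 1ℚ :+ x := (con 1ℚ :+ x) :* con ½ :+ (con 1ℚ :+ x) :* con ½) refl x)
    (≤+ˡ x (ℚ.<⇒≤ 0<1))

-- The estimate for p ln (p/q) at a single string.

*-inv-quotient : ∀ {p q} → 0ℚ ℚ.< p → 0ℚ ℚ.< q → p ℚ.* inv (p ℚ.* inv q) ≡ q
*-inv-quotient {p} {q} 0<p 0<q = begin
  p ℚ.* w                      ≡⟨ ℚ.*-identityʳ (p ℚ.* w) ⟨
  (p ℚ.* w) ℚ.* 1ℚ             ≡⟨ cong ((p ℚ.* w) ℚ.*_) (inv-inverseʳ 0<q) ⟨
  (p ℚ.* w) ℚ.* (q ℚ.* inv q)  ≡⟨ solve 4 (λ p w q v → (p :* w) :* (q :* v) := q :* ((p :* v) :* w)) refl p w q (inv q) ⟩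
  q ℚ.* ((p ℚ.* inv q) ℚ.* w)  ≡⟨ cong (q ℚ.*_) (inv-inverseʳ (0<* 0<p (inv-pos 0<q))) ⟩
  q ℚ.* 1ℚ                     ≡⟨ ℚ.*-identityʳ q ⟩
  q                            ∎
  where
  open ≡-Reasoning
  w : ℚ
  w = inv (p ℚ.* inv q)

-- At x = p/q the factor p turns the error term 1/x into q, so the loss is measured by μ instead of
-- ν. Monotonicity in the number of halvings passes from j to the n of the approximation to the
-- logarithm.
weighted-lower : ∀ {j n} → j ℕ.≤ n → ∀ {p q} → 0ℚ ℚ.< p → 0ℚ ℚ.< q →
  p ℚ.* (1ℚ ℚ.+ ι j ℚ.* ½) ℚ.≤
    p ℚ.* riemann inv n 1ℚ (p ℚ.* inv q) ℚ.+ (2⁺ (suc j) ℚ.- 1ℚ) ℚ.* q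
weighted-lower {j} {n} j≤n {p} {q} 0<p 0<q = begin
  p ℚ.* (1ℚ ℚ.+ ι j ℚ.* ½)
    ≤⟨ *-monoʳ (ℚ.<⇒≤ 0<p) (ℚ.≤-trans (riemann-inv-lower j 0<x)
         (ℚ.+-monoˡ-≤ (t ℚ.* inv x) (riemann-inv-mono j≤n 0<1 0<x))) ⟩
  p ℚ.* (R ℚ.+ t ℚ.* inv x)
    ≡⟨ solve 4 (λ p r t w → p :* (r :+ t :* w) := p :* r :+ t :* (p :* w)) refl p R t (inv x) ⟩
  p ℚ.* R ℚ.+ t ℚ.* (p ℚ.* inv x)
    ≡⟨ cong (λ s → p ℚ.* R ℚ.+ t ℚ.* s) (*-inv-quotient 0<p 0<q) ⟩
  p ℚ.* R ℚ.+ t ℚ.* q ∎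
  where
  open ℚ.≤-Reasoning
  x t R : ℚ
  x = p ℚ.* inv q
  t = 2⁺ (suc j) ℚ.- 1ℚ
  R = riemann inv n 1ℚ x
  0<x : 0ℚ ℚ.< x
  0<x = 0<* 0<p (inv-pos 0<q)

if-lower : ∀ (b : Bool) {j n} → j ℕ.≤ n → ∀ {x y : ℝ} → 0ℚ ℚ.< seq x n → 0ℚ ℚ.< seq y n →
  (ι j ℚ.* ½) ℚ.* seq (if b then x else 0ℝ) n ℚ.≤
    (seq x n ℚ.* riemann inv n 1ℚ (seq x n ℚ.* inv (seq y n)) ℚ.+ seq y n) ℚ.+
      2⁺ (suc j) ℚ.* seq (if b then y else 0ℝ) n
if-lower true {j} {n} j≤n {x} {y} 0<p 0<q = begin
  h ℚ.* p
    -- The 1 in 1 + j/2 is given away; only the growth in j matters.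
    ≤⟨ ≤+ˡ (h ℚ.* p) (ℚ.<⇒≤ 0<p) ⟩
  p ℚ.+ h ℚ.* p
    ≡⟨ solve 2 (λ p h → p :+ h :* p := p :* (con 1ℚ :+ h)) refl p h ⟩
  p ℚ.* (1ℚ ℚ.+ h)
    ≤⟨ weighted-lower j≤n 0<p 0<q ⟩
  r ℚ.+ (2⁺ (suc j) ℚ.- 1ℚ) ℚ.* q
    -- Slack 2q gives this case the same shape as the one off the set.
    ≤⟨ ≤+ʳ (r ℚ.+ (2⁺ (suc j) ℚ.- 1ℚ) ℚ.* q) (0≤+ (ℚ.<⇒≤ 0<q) (ℚ.<⇒≤ 0<q)) ⟩
  (r ℚ.+ (2⁺ (suc j) ℚ.- 1ℚ) ℚ.* q) ℚ.+ (q ℚ.+ q)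
    ≡⟨ solve 3 (λ r s q → (r :+ (s :- con 1ℚ) :* q) :+ (q :+ q) := (r :+ q) :+ s :* q)
         refl r (2⁺ (suc j)) q ⟩
  (r ℚ.+ q) ℚ.+ 2⁺ (suc j) ℚ.* q ∎
  where
  open ℚ.≤-Reasoning
  p q h r : ℚ
  p = seq x n
  q = seq y n
  h = ι j ℚ.* ½
  r = p ℚ.* riemann inv n 1ℚ (p ℚ.* inv q)
if-lower false {j} {n} j≤n {x} {y} 0<p 0<q = begin
  h ℚ.* 0ℚ
    ≡⟨ ℚ.*-zeroʳ h ⟩
  0ℚ
    ≤⟨ ℚ.<⇒≤ 0<p ⟩
  p
    ≡⟨ solve 1 (λ p → p := p :* (con 1ℚ :+ con 0ℚ :* con ½)) refl p ⟩
  p ℚ.* (1ℚ ℚ.+ 0ℚ ℚ.* ½)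
    -- For j = 0 the coefficient 2^1 - 1 is 1, so a string off the set costs a single q; over a
    -- whole level these add up to at most 1 in the limit.
    ≤⟨ weighted-lower {0} {n} ℕ.z≤n 0<p 0<q ⟩
  r ℚ.+ (2⁺ 1 ℚ.- 1ℚ) ℚ.* q
    ≡⟨ solve 3 (λ r s q → r :+ ((con 1ℚ :+ con 1ℚ) :- con 1ℚ) :* q := (r :+ q) :+ s :* con 0ℚ)
         refl r (2⁺ (suc j)) q ⟩
  (r ℚ.+ q) ℚ.+ 2⁺ (suc j) ℚ.* 0ℚ ∎
  where
  open ℚ.≤-Reasoning
  p q h r : ℚ
  p = seq x n
  q = seq y n
  h = ι j ℚ.* ½
  r = p ℚ.* riemann inv n 1ℚ (p ℚ.* inv q)

-- Asymptotic inequalities between rational sequences, and finite sums.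

infix 4 _≲_

-- x ≤ y unfolds to seq x ≲ seq y; working with sequences keeps the type checker from
-- comparing the Cauchy proofs of convertible reals.
_≲_ : (ℕ → ℚ) → (ℕ → ℚ) → Set
x ≲ y = ∀ ε → 0ℚ ℚ.< ε → ∃[ N ] (∀ n → N ℕ.≤ n → x n ℚ.≤ y n ℚ.+ ε)

≲-trans : ∀ {x y z} → x ≲ y → y ≲ z → x ≲ z
≲-trans {x} {y} {z} x≲y y≲z ε 0<ε =
    N₁ ℕ.⊔ N₂ , λ n N≤n → subst (x n ℚ.≤_)
      (solve 2 (λ z e → (z :+ e :* con ½) :+ e :* con ½ := z :+ e) refl (z n) ε)
      (ℚ.≤-trans (proj₂ (x≲y δ 0<δ) n (ℕ.m⊔n≤o⇒m≤o N₁ N₂ N≤n))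
        (ℚ.+-monoˡ-≤ δ (proj₂ (y≲z δ 0<δ) n (ℕ.m⊔n≤o⇒n≤o N₁ N₂ N≤n))))
  where
  δ : ℚ
  δ = ε ℚ.* ½
  0<δ : 0ℚ ℚ.< δ
  0<δ = 0<* 0<ε 0<½
  N₁ N₂ : ℕ
  N₁ = proj₁ (x≲y δ 0<δ)
  N₂ = proj₁ (y≲z δ 0<δ)

+-mono-≲ : ∀ {x y u v} → x ≲ y → u ≲ v → (λ n → x n ℚ.+ u n) ≲ (λ n → y n ℚ.+ v n)
+-mono-≲ {x} {y} {u} {v} x≲y u≲v ε 0<ε =
    N₁ ℕ.⊔ N₂ , λ n N≤n → subst (x n ℚ.+ u n ℚ.≤_)
      (solve 3 (λ y v e → (y :+ e :* con ½) :+ (v :+ e :* con ½) := (y :+ v) :+ e) refl (y n) (v n) ε)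
      (ℚ.+-mono-≤ (proj₂ (x≲y δ 0<δ) n (ℕ.m⊔n≤o⇒m≤o N₁ N₂ N≤n))
        (proj₂ (u≲v δ 0<δ) n (ℕ.m⊔n≤o⇒n≤o N₁ N₂ N≤n)))
  where
  δ : ℚ
  δ = ε ℚ.* ½
  0<δ : 0ℚ ℚ.< δ
  0<δ = 0<* 0<ε 0<½
  N₁ N₂ : ℕ
  N₁ = proj₁ (x≲y δ 0<δ)
  N₂ = proj₁ (u≲v δ 0<δ)

≗⇒≲ : ∀ {x y} → (∀ n → x n ≡ y n) → x ≲ y
≗⇒≲ {x} {y} x≗y ε 0<ε = 0 , λ n _ →
  ℚ.≤-trans (ℚ.≤-reflexive (x≗y n)) (≤+ʳ (y n) (ℚ.<⇒≤ 0<ε))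

≈⇒≲ : ∀ {x y} → x ≈ y → seq x ≲ seq y
≈⇒≲ {x} {y} x≈y ε 0<ε = proj₁ (x≈y ε 0<ε) , λ n N≤n →
  p-q≤r⇒p≤q+r (seq x n) (seq y n) ε
    (ℚ.≤-trans (p≤∣p∣ (seq x n ℚ.- seq y n)) (proj₂ (x≈y ε 0<ε) n N≤n))

≈⇒≳ : ∀ {x y} → x ≈ y → seq y ≲ seq x
≈⇒≳ {x} {y} x≈y ε 0<ε = proj₁ (x≈y ε 0<ε) , λ n N≤n →
  p-q≤r⇒p≤q+r (seq y n) (seq x n) ε (ℚ.≤-trans (p≤∣p∣ (seq y n ℚ.- seq x n))
    (subst (ℚ._≤ ε) (∣-∣-swap (seq x n) (seq y n)) (proj₂ (x≈y ε 0<ε) n N≤n)))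

∑-mono-≲ : ∀ {A : Set} (as : List A) {f g : A → ℝ} →
  (∀ a → seq (f a) ≲ seq (g a)) → seq (∑ as f) ≲ seq (∑ as g)
∑-mono-≲ []       f≲g = ≗⇒≲ {λ _ → 0ℚ} {λ _ → 0ℚ} (λ _ → refl)
∑-mono-≲ (a ∷ as) {f} {g} f≲g =
  +-mono-≲ {seq (f a)} {seq (g a)} {seq (∑ as f)} {seq (∑ as g)} (f≲g a) (∑-mono-≲ as {f} {g} f≲g)

-- Conversion checking p ℚ.+ q against a term with another head unfolds rational addition;
-- the equations below are used instead wherever sums would be nested.
seq-+ : ∀ x y n → seq (x + y) n ≡ seq x n ℚ.+ seq y n
seq-+ _ _ _ = refl

seq-* : ∀ x y n → seq (x * y) n ≡ seq x n ℚ.* seq y n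
seq-* _ _ _ = refl

∑-cons : ∀ {A : Set} (a : A) as (f : A → ℝ) n →
  seq (∑ (a ∷ as) f) n ≡ seq (f a) n ℚ.+ seq (∑ as f) n
∑-cons a as f n = seq-+ (f a) (∑ as f) n

childrenSum : (String → ℝ) → String → ℝ
childrenSum f σ = f (σ ∷ʳ false) + f (σ ∷ʳ true)

∑-children : ∀ (σs : List String) (f : String → ℝ) n →
  seq (∑ (concatMap (λ σ → (σ ∷ʳ false) ∷ (σ ∷ʳ true) ∷ []) σs) f) n ≡
  seq (∑ σs (childrenSum f)) n
∑-children []       f n = refl
∑-children (σ ∷ σs) f n = begin
  seq (∑ ((σ ∷ʳ false) ∷ (σ ∷ʳ true) ∷ rest) f) n
    ≡⟨ ∑-cons (σ ∷ʳ false) ((σ ∷ʳ true) ∷ rest) f n ⟩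
  p ℚ.+ seq (∑ ((σ ∷ʳ true) ∷ rest) f) n
    ≡⟨ cong (p ℚ.+_) (∑-cons (σ ∷ʳ true) rest f n) ⟩
  p ℚ.+ (q ℚ.+ seq (∑ rest f) n)
    ≡⟨ ℚ.+-assoc p q (seq (∑ rest f) n) ⟨
  (p ℚ.+ q) ℚ.+ seq (∑ rest f) n
    ≡⟨ cong₂ ℚ._+_ (sym (seq-+ (f (σ ∷ʳ false)) (f (σ ∷ʳ true)) n)) (∑-children σs f n) ⟩
  seq (childrenSum f σ) n ℚ.+ seq (∑ σs (childrenSum f)) n
    ≡⟨ ∑-cons σ σs (childrenSum f) n ⟨
  seq (∑ (σ ∷ σs) (childrenSum f)) n ∎
  where
  open ≡-Reasoning
  rest : List String
  rest = concatMap (λ σ → (σ ∷ʳ false) ∷ (σ ∷ʳ true) ∷ []) σs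
  p q : ℚ
  p = seq (f (σ ∷ʳ false)) n
  q = seq (f (σ ∷ʳ true)) n

-- Grouping siblings and applying additivity leads from level `suc n` to level `n`, and finally to
-- `total`.
∑-strings≲1 : ∀ (μ : Measure) n → seq (∑ (strings n) (val μ)) ≲ (λ _ → 1ℚ)
∑-strings≲1 μ zero = ≲-trans {λ n → seq (val μ []) n ℚ.+ 0ℚ} {seq (val μ [])} {λ _ → 1ℚ}
  (≗⇒≲ (λ n → ℚ.+-identityʳ (seq (val μ []) n)))
  (≈⇒≲ {val μ []} {1ℝ} (total μ))
∑-strings≲1 μ (suc n) =
  ≲-trans {seq (∑ (strings (suc n)) (val μ))} {seq (∑ (strings n) (childrenSum (val μ)))} {λ _ → 1ℚ}
    (≗⇒≲ (∑-children (strings n) (val μ)))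
  (≲-trans {seq (∑ (strings n) (childrenSum (val μ)))} {seq (∑ (strings n) (val μ))} {λ _ → 1ℚ}
    (∑-mono-≲ (strings n) {childrenSum (val μ)} {val μ}
      (λ σ → ≈⇒≳ {val μ σ} {val μ (σ ∷ʳ false) + val μ (σ ∷ʳ true)} (additive μ σ)))
    (∑-strings≲1 μ n))

-- Summing the estimate over a list of strings.

eventually-pos : ∀ {A : Set} {f : A → ℝ} → (∀ a → 0ℝ < f a) → (as : List A) →
  ∃[ N ] (∀ n → N ℕ.≤ n → All (λ a → 0ℚ ℚ.< seq (f a) n) as)
eventually-pos f>0 [] = 0 , λ _ _ → []
eventually-pos {f = f} f>0 (a ∷ as) with pos-lower {f a} (f>0 a) | eventually-pos {f = f} f>0 as
... | c , 0<c , N₁ , c≤ | N₂ , pos = N₁ ℕ.⊔ N₂ , λ n N≤n →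
  ℚ.<-≤-trans 0<c (c≤ n (ℕ.m⊔n≤o⇒m≤o N₁ N₂ N≤n)) ∷ pos n (ℕ.m⊔n≤o⇒n≤o N₁ N₂ N≤n)

-- The sums enter as variables with equations, so that matching on `refl` leaves only linear
-- algebra.
add-bounds : ∀ h t {s s₁ s₂ r r₁ r₂ q q₁ q₂ u u₁ u₂ : ℚ} →
  s ≡ s₁ ℚ.+ s₂ → r ≡ r₁ ℚ.+ r₂ → q ≡ q₁ ℚ.+ q₂ → u ≡ u₁ ℚ.+ u₂ →
  h ℚ.* s₁ ℚ.≤ (r₁ ℚ.+ q₁) ℚ.+ t ℚ.* u₁ →
  h ℚ.* s₂ ℚ.≤ (r₂ ℚ.+ q₂) ℚ.+ t ℚ.* u₂ →
  h ℚ.* s ℚ.≤ (r ℚ.+ q) ℚ.+ t ℚ.* u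
add-bounds h t {s₁ = s₁} {s₂} {r₁ = r₁} {r₂} {q₁ = q₁} {q₂} {u₁ = u₁} {u₂} refl refl refl refl le₁ le₂ =
  subst₂ ℚ._≤_ (sym (ℚ.*-distribˡ-+ h s₁ s₂))
    (solve 7 (λ r q u r′ q′ u′ t →
        ((r :+ q) :+ t :* u) :+ ((r′ :+ q′) :+ t :* u′) :=
        ((r :+ r′) :+ (q :+ q′)) :+ t :* (u :+ u′))
      refl r₁ q₁ u₁ r₂ q₂ u₂ t)
    (ℚ.+-mono-≤ le₁ le₂)

-- The inequality is between the n-th rational approximations, where the logarithm is literally a
-- Riemann sum with 2^n pieces. It is `if-lower` summed term by term.
∑-log-lower : ∀ {A : Set} (b : A → Bool) {f g ℓ : A → ℝ} →
  (∀ a n → seq (ℓ a) n ≡ riemann inv n 1ℚ (seq (f a) n ℚ.* inv (seq (g a) n))) →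
  ∀ {j n} → j ℕ.≤ n → ∀ {as} →
  All (λ a → 0ℚ ℚ.< seq (f a) n) as → All (λ a → 0ℚ ℚ.< seq (g a) n) as →
  (ι j ℚ.* ½) ℚ.* seq (∑ as (λ a → if b a then f a else 0ℝ)) n ℚ.≤
    (seq (∑ as (λ a → f a * ℓ a)) n ℚ.+ seq (∑ as g) n)
    ℚ.+ 2⁺ (suc j) ℚ.* seq (∑ as (λ a → if b a then g a else 0ℝ)) n
∑-log-lower b ℓ≡ {j} j≤n [] [] = ℚ.≤-reflexive
  (solve 2 (λ h t → h :* con 0ℚ := (con 0ℚ :+ con 0ℚ) :+ t :* con 0ℚ) refl (ι j ℚ.* ½) (2⁺ (suc j)))
∑-log-lower b {f} {g} {ℓ} ℓ≡ {j} {n} j≤n {a ∷ as} (0<p ∷ ps) (0<q ∷ qs) =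
  add-bounds (ι j ℚ.* ½) (2⁺ (suc j))
    {s₁ = seq (if b a then f a else 0ℝ) n} {seq (∑ as (λ a → if b a then f a else 0ℝ)) n}
    {r₁ = seq (f a) n ℚ.* riemann inv n 1ℚ (seq (f a) n ℚ.* inv (seq (g a) n))} {seq (∑ as (λ a → f a * ℓ a)) n}
    {q₁ = seq (g a) n} {seq (∑ as g) n}
    {u₁ = seq (if b a then g a else 0ℝ) n} {seq (∑ as (λ a → if b a then g a else 0ℝ)) n}
    (∑-cons a as (λ a → if b a then f a else 0ℝ) n)
    (trans (∑-cons a as (λ a → f a * ℓ a) n) (cong (ℚ._+ seq (∑ as (λ a → f a * ℓ a)) n)
      (trans (seq-* (f a) (ℓ a) n) (cong (seq (f a) n ℚ.*_) (ℓ≡ a n)))))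
    (∑-cons a as g n)
    (∑-cons a as (λ a → if b a then g a else 0ℝ) n)
    (if-lower (b a) j≤n {f a} {g a} 0<p 0<q)
    (∑-log-lower b {f} {g} {ℓ} ℓ≡ j≤n ps qs)

-- The indices K 2^m and their computability.

_·2^_ : ℕ → ℕ → ℕ
K ·2^ zero  = K
K ·2^ suc m = (K ·2^ m) ℕ.+ (K ·2^ m)

ι-·2^ : ∀ K m → ι (K ·2^ m) ≡ ι K ℚ.* 2⁺ m
ι-·2^ K zero    = sym (ℚ.*-identityʳ (ι K))
ι-·2^ K (suc m) = trans (ι-+ (K ·2^ m) (K ·2^ m))
  (trans (cong₂ ℚ._+_ (ι-·2^ K m) (ι-·2^ K m)) (sym (ℚ.*-distribˡ-+ (ι K) (2⁺ m) (2⁺ m))))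

constᶜ : ∀ {n} → ℕ → Rec n
constᶜ zero    = comp zero []
constᶜ (suc k) = comp suc (constᶜ k ∷ [])

constᶜ⇓ : ∀ {n} k {xs} → constᶜ {n} k [ xs ]⇓ k
constᶜ⇓ zero    = comp⇓ [] zero⇓
constᶜ⇓ (suc k) = comp⇓ (constᶜ⇓ k ∷ []) suc⇓

addᶜ : Rec 2
addᶜ = prec (proj zero) (comp suc (proj (suc zero) ∷ []))

addᶜ⇓ : ∀ m n → addᶜ [ m ∷ n ∷ [] ]⇓ (m ℕ.+ n)
addᶜ⇓ zero    n = prec₀⇓ proj⇓
addᶜ⇓ (suc m) n = precₛ⇓ (addᶜ⇓ m n) (comp⇓ (proj⇓ ∷ []) suc⇓)

·2^ᶜ : ℕ → Rec 1
-- In the recursion step, argument 0 is the counter and argument 1 the previous value, which is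
-- added to itself.
·2^ᶜ K = prec (constᶜ K) (comp addᶜ (proj (suc zero) ∷ proj (suc zero) ∷ []))

·2^ᶜ⇓ : ∀ K m → ·2^ᶜ K [ m ∷ [] ]⇓ (K ·2^ m)
·2^ᶜ⇓ K zero    = prec₀⇓ (constᶜ⇓ K)
·2^ᶜ⇓ K (suc m) = precₛ⇓ (·2^ᶜ⇓ K m) (comp⇓ (proj⇓ ∷ proj⇓ ∷ []) (addᶜ⇓ (K ·2^ m) (K ·2^ m)))

-- K is a fixed number and is hard-wired into the code by `constᶜ`.
computable-reindex : ∀ {f} → Computable₂ f → ∀ K → Computable₂ (λ m k → f (suc (K ·2^ m)) k)
computable-reindex (c , c⇓) K =
    comp c (comp suc (comp (·2^ᶜ K) (proj zero ∷ []) ∷ []) ∷ proj (suc zero) ∷ [])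
  , λ m k → comp⇓ (comp⇓ (comp⇓ (proj⇓ ∷ []) (·2^ᶜ⇓ K m) ∷ []) suc⇓ ∷ proj⇓ ∷ [])
      (c⇓ (suc (K ·2^ m)) k)

-- The constant K and the bound on clopen sets.

cancel-scale : ∀ {B s} K m → 0ℚ ℚ.< B → B ℚ.+ B ℚ.≤ ι K →
  (ι (K ·2^ m) ℚ.* ½) ℚ.* s ℚ.≤ B → s ℚ.≤ 2⁻ m
cancel-scale {B} {s} K m 0<B 2B≤ιK hs≤B = begin
  s                          ≡⟨ ℚ.*-identityˡ s ⟨
  1ℚ ℚ.* s                   ≡⟨ cong (ℚ._* s) (2⁻*2⁺≡1 m) ⟨
  (2⁻ m ℚ.* 2⁺ m) ℚ.* s      ≡⟨ ℚ.*-assoc (2⁻ m) (2⁺ m) s ⟩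
  2⁻ m ℚ.* (2⁺ m ℚ.* s)      ≤⟨ *-monoʳ (ℚ.<⇒≤ (2⁻-pos m)) 2⁺*s≤1 ⟩
  2⁻ m ℚ.* 1ℚ                ≡⟨ ℚ.*-identityʳ (2⁻ m) ⟩
  2⁻ m                       ∎
  where
  open ℚ.≤-Reasoning
  H : ℚ
  H = ι K ℚ.* ½
  B≤H : B ℚ.≤ H
  B≤H = subst (ℚ._≤ H) (solve 1 (λ b → (b :+ b) :* con ½ := b) refl B) (*-monoˡ (ℚ.<⇒≤ 0<½) 2B≤ιK)
  -- Since K ≥ 2B absorbs the factor 1/2, H 2^m s ≤ B ≤ H, and H > 0 cancels.
  2⁺*s≤1 : 2⁺ m ℚ.* s ℚ.≤ 1ℚ
  2⁺*s≤1 = ℚ.*-cancelˡ-≤-pos H {{ℚ.positive (ℚ.<-≤-trans 0<B B≤H)}} (begin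
    H ℚ.* (2⁺ m ℚ.* s)
      ≡⟨ solve 3 (λ k t s → (k :* con ½) :* (t :* s) := ((k :* t) :* con ½) :* s) refl (ι K) (2⁺ m) s ⟩
    ((ι K ℚ.* 2⁺ m) ℚ.* ½) ℚ.* s     ≡⟨ cong (λ i → (i ℚ.* ½) ℚ.* s) (ι-·2^ K m) ⟨
    (ι (K ·2^ m) ℚ.* ½) ℚ.* s        ≤⟨ hs≤B ⟩
    B                                ≤⟨ B≤H ⟩
    H                                ≡⟨ ℚ.*-identityʳ H ⟨
    H ℚ.* 1ℚ                         ∎)

-- 1 for the error of 𝔼 ln (ν/μ) ≤ C, 2 ≥ μ(2^ℕ) and 2 ≥ 2^n μ(A), all up to approximation.
add-5 : ℚ → ℚ
add-5 B = ((B ℚ.+ 1ℚ) ℚ.+ (1ℚ ℚ.+ 1ℚ)) ℚ.+ (1ℚ ℚ.+ 1ℚ)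

0<add-5 : ∀ {B} → 0ℚ ℚ.< B → 0ℚ ℚ.< add-5 B
0<add-5 0<B = 0<+ (0<+ (0<+ 0<B (ℚ.<⇒≤ 0<1)) 0≤2) 0≤2
  where
  0≤2 : 0ℚ ℚ.≤ 1ℚ ℚ.+ 1ℚ
  0≤2 = 0≤+ (ℚ.<⇒≤ 0<1) (ℚ.<⇒≤ 0<1)

collect-bounds : ∀ {hs e q u c B} j → hs ℚ.≤ (e ℚ.+ q) ℚ.+ 2⁺ j ℚ.* u →
  e ℚ.≤ c ℚ.+ 1ℚ → c ℚ.≤ B → q ℚ.≤ 1ℚ ℚ.+ 1ℚ → u ℚ.≤ 2⁻ j ℚ.+ 2⁻ j → hs ℚ.≤ add-5 B
collect-bounds j hs≤ e≤ c≤B q≤ u≤ = ℚ.≤-trans hs≤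
  (ℚ.+-mono-≤ (ℚ.+-mono-≤ (ℚ.≤-trans e≤ (ℚ.+-monoˡ-≤ 1ℚ c≤B)) q≤)
    (ℚ.≤-trans (*-monoʳ (0≤2⁺ j) u≤) (ℚ.≤-reflexive (trans
      (solve 2 (λ t d → t :* (d :+ d) := d :* t :+ d :* t) refl (2⁺ j) (2⁻ j))
      (cong₂ ℚ._+_ (2⁻*2⁺≡1 j) (2⁻*2⁺≡1 j))))))

klScale : ℚ → ℕ
klScale B = proj₁ (archimedean (add-5 B ℚ.+ add-5 B))

klScale-large : ∀ B → add-5 B ℚ.+ add-5 B ℚ.≤ ι (klScale B)
klScale-large B = proj₂ (archimedean (add-5 B ℚ.+ add-5 B))

-- With j = K 2^m, the factor 2^(j+1) of the logarithm estimate cancels against μ(A) ≤ 2^(-(j+1));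
-- hence the successor in the index. What remains is (j/2) ν(A) ≤ B + 5, which the choice of K turns
-- into ν(A) ≤ 2^(-m).
clopen-bound : ∀ (ν μ : Measure) → FullSupport ν → FullSupport μ →
  ∀ {B} → 0ℚ ℚ.< B → ∀ {C N₀} → (∀ n → N₀ ℕ.≤ n → ∣ seq C n ∣ ℚ.≤ B) → ∀ {ℓ : String → ℝ} →
  (∀ n → seq (∑ (strings n) (λ σ → val ν σ * ℓ σ)) ≲ seq C) →
  (∀ σ n → seq (ℓ σ) n ≡ riemann inv n 1ℚ (seq (val ν σ) n ℚ.* inv (seq (val μ σ) n))) →
  ∀ L (b : String → Bool) m →
  ∑ (strings L) (λ σ → if b σ then val μ σ else 0ℝ) ≤ fromℚ (2⁻ (suc (klScale B ·2^ m))) →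
  ∑ (strings L) (λ σ → if b σ then val ν σ else 0ℝ) ≤ fromℚ (2⁻ m)
clopen-bound ν μ ν>0 μ>0 {B} 0<B {C} {N₀} C≤B {ℓ} 𝔼ℓ≤C ℓ≡ L b m μA≤ ε 0<ε =
    N , λ n N≤n → ℚ.≤-trans
      (cancel-scale {add-5 B} {s n} (klScale B) m (0<add-5 0<B) (klScale-large B) (bound n N≤n))
      -- Late approximations are already at most 2^(-m), so ε is spare.
      (≤+ʳ (2⁻ m) (ℚ.<⇒≤ 0<ε))
  where
  j : ℕ
  j = klScale B ·2^ m
  evE = 𝔼ℓ≤C L 1ℚ 0<1
  evμ = ∑-strings≲1 μ L 1ℚ 0<1
  -- The tolerance is as small as the bound itself because it gets multiplied by 2^(j+1).
  evA = μA≤ (2⁻ (suc j)) (2⁻-pos (suc j))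
  -- The estimate needs positive rationals; a level has finitely many strings, so one index serves
  -- all of them.
  posν = eventually-pos {f = val ν} ν>0 (strings L)
  posμ = eventually-pos {f = val μ} μ>0 (strings L)
  N₁ N₂ N₃ N₄ N₅ N : ℕ
  -- From j on the Riemann sums are fine enough; from N₀ on B bounds C.
  N₁ = j ℕ.⊔ N₀
  N₂ = N₁ ℕ.⊔ proj₁ evE
  N₃ = N₂ ℕ.⊔ proj₁ evμ
  N₄ = N₃ ℕ.⊔ proj₁ evA
  N₅ = N₄ ℕ.⊔ proj₁ posν
  N = N₅ ℕ.⊔ proj₁ posμ
  s : ℕ → ℚ
  s = seq (∑ (strings L) (λ σ → if b σ then val ν σ else 0ℝ))
  bound : ∀ n → N ℕ.≤ n → (ι j ℚ.* ½) ℚ.* s n ℚ.≤ add-5 B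
  bound n N≤n = collect-bounds {(ι j ℚ.* ½) ℚ.* s n}
      {seq (∑ (strings L) (λ σ → val ν σ * ℓ σ)) n} {seq (∑ (strings L) (val μ)) n}
      {seq (∑ (strings L) (λ σ → if b σ then val μ σ else 0ℝ)) n}
      {seq C n} {B} (suc j)
      (∑-log-lower b {val ν} {val μ} {ℓ} ℓ≡ j≤n (proj₂ posν n ν≤n) (proj₂ posμ n μ≤n))
      (proj₂ evE n E≤n)
      (ℚ.≤-trans (p≤∣p∣ (seq C n)) (C≤B n C≤n))
      (proj₂ evμ n S≤n)
      (proj₂ evA n A≤n)
    where
    N₅≤n = ℕ.m⊔n≤o⇒m≤o N₅ (proj₁ posμ) N≤n
    N₄≤n = ℕ.m⊔n≤o⇒m≤o N₄ (proj₁ posν) N₅≤n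
    N₃≤n = ℕ.m⊔n≤o⇒m≤o N₃ (proj₁ evA) N₄≤n
    N₂≤n = ℕ.m⊔n≤o⇒m≤o N₂ (proj₁ evμ) N₃≤n
    N₁≤n = ℕ.m⊔n≤o⇒m≤o N₁ (proj₁ evE) N₂≤n
    j≤n = ℕ.m⊔n≤o⇒m≤o j N₀ N₁≤n
    C≤n = ℕ.m⊔n≤o⇒n≤o j N₀ N₁≤n
    E≤n = ℕ.m⊔n≤o⇒n≤o N₁ (proj₁ evE) N₂≤n
    S≤n = ℕ.m⊔n≤o⇒n≤o N₂ (proj₁ evμ) N₃≤n
    A≤n = ℕ.m⊔n≤o⇒n≤o N₃ (proj₁ evA) N₄≤n
    ν≤n = ℕ.m⊔n≤o⇒n≤o N₄ (proj₁ posν) N₅≤n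
    μ≤n = ℕ.m⊔n≤o⇒n≤o N₅ (proj₁ posμ) N≤n

-- Finite unions of cylinders, and the transfer of tests.

maxLength : List String → ℕ
maxLength = foldr (λ σ l → length σ ℕ.⊔ l) 0

inUnion : List String → String → Bool
inUnion σs τ = does (any? (λ σ → prefix? Bool._≟_ σ τ) σs)

-- Exhibits a finite union as a clopen set given by a level and a Boolean predicate, the form to
-- which the clopen bound applies.
measure-⋃-def : ∀ ρ σs → measure-⋃ ρ σs ≡
  ∑ (strings (maxLength σs)) (λ τ → if inUnion σs τ then val ρ τ else 0ℝ)
measure-⋃-def ρ σs = refl

logRatio : ∀ ν μ → FullSupport ν → FullSupport μ → String → ℝ
logRatio ν μ ν>0 μ>0 σ =
  ln (val ν σ / val μ σ ⟨ μ>0 σ ⟩) (/-pos {val ν σ} {val μ σ} (ν>0 σ) (μ>0 σ))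

-- KLBounded is stated with a copy of logRatio local to it.  Comparing the two as reals would
-- compare their Cauchy proofs, so the summand is left to unification as a variable step
-- function F, and only its rational values are compared.
foldr-step-≲ : ∀ {A : Set} {F : A → ℝ → ℝ} {as : ℕ → List A} {c : ℕ → ℚ} (f ℓ : A → ℝ) →
  (∀ n → seq (foldr F 0ℝ (as n)) ≲ c) →
  (∀ a s k → seq (F a s) k ≡ seq (f a) k ℚ.* seq (ℓ a) k ℚ.+ seq s k) →
  ∀ n → seq (∑ (as n) (λ a → f a * ℓ a)) ≲ c
foldr-step-≲ {A} {F} {as} {c} f ℓ h step n =
  ≲-trans {seq (∑ (as n) (λ a → f a * ℓ a))} {seq (foldr F 0ℝ (as n))} {c}
    (≗⇒≲ (λ k → sym (equal (as n) k))) (h n)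
  where
  equal : ∀ bs k → seq (foldr F 0ℝ bs) k ≡ seq (∑ bs (λ a → f a * ℓ a)) k
  equal []       k = refl
  equal (a ∷ bs) k = trans (step a (foldr F 0ℝ bs) k)
    (trans (cong₂ ℚ._+_ (sym (seq-* (f a) (ℓ a) k)) (equal bs k))
      (sym (∑-cons a bs (λ a → f a * ℓ a) k)))

-- K comes from a bound on C alone, hence is chosen before the level, the clopen set and m; one K
-- serves the whole test.
kl-clopen-bound : ∀ ν μ (ν>0 : FullSupport ν) (μ>0 : FullSupport μ) → KLBounded ν μ ν>0 μ>0 →
  ∃[ K ] (∀ L (b : String → Bool) m →
    ∑ (strings L) (λ σ → if b σ then val μ σ else 0ℝ) ≤ fromℚ (2⁻ (suc (K ·2^ m))) →
    ∑ (strings L) (λ σ → if b σ then val ν σ else 0ℝ) ≤ fromℚ (2⁻ m))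
kl-clopen-bound ν μ ν>0 μ>0 (C , 𝔼≤C) =
  let B , 0<B , _ , C≤B = cauchy-bounded C in
  klScale B , clopen-bound ν μ ν>0 μ>0 0<B {C} C≤B {logRatio ν μ ν>0 μ>0}
    (foldr-step-≲ {as = strings} {seq C} (val ν) (logRatio ν μ ν>0 μ>0) 𝔼≤C (λ _ _ _ → refl))
    (λ _ _ → refl)

-- Level and predicate depend only on `σs`, so both measures are sums over the same clopen set.
union-bound : ∀ ν μ σs p q →
  (∀ L (b : String → Bool) →
    ∑ (strings L) (λ σ → if b σ then val μ σ else 0ℝ) ≤ fromℚ p →
    ∑ (strings L) (λ σ → if b σ then val ν σ else 0ℝ) ≤ fromℚ q) →
  measure-⋃ μ σs ≤ fromℚ p → measure-⋃ ν σs ≤ fromℚ q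
union-bound ν μ σs p q h μ≤ = subst (_≤ fromℚ q) (sym (measure-⋃-def ν σs))
  (h (maxLength σs) (inUnion σs) (subst (_≤ fromℚ p) (measure-⋃-def μ σs) μ≤))

proposition1p17 : (ν μ : Measure) → ComputableMeasure ν → ComputableMeasure μ →
    (ν>0 : FullSupport ν) (μ>0 : FullSupport μ) →
    KLBounded ν μ ν>0 μ>0 → ν ≪MLR μ
proposition1p17 ν μ _ _ ν>0 μ>0 kl ω ω∈MLRν U U-computable μU≤ ω∈U =
  -- A point of every U_n lies in every member of this subsequence, which is a ν-test.
  ω∈MLRν (λ m → U (suc (K ·2^ m)))
    (computable-reindex U-computable K)
    -- The measure of an open set is bounded through its finite partial unions, so the clopen bound
    -- is applied to each of them.
    (λ m k → union-bound ν μ (applyUpTo (U (suc (K ·2^ m))) k) (2⁻ (suc (K ·2^ m))) (2⁻ m)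
      (λ L b → proj₂ bound L b m) (μU≤ (suc (K ·2^ m)) k))
    (λ m → ω∈U (suc (K ·2^ m)))
  where
  bound = kl-clopen-bound ν μ ν>0 μ>0 kl
  K : ℕ
  K = proj₁ bound
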